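{- Let $n$ be a perfect square. Suppose Alice receives a uniformly random matrix $M\in\mathbb{F}_2^{\sqrt n\times\sqrt n}$ and Bob receives a uniformly random pair $(u,v)\in\mathbb{F}_2^{\sqrt n}\times\mathbb{F}_2^{\sqrt n}$, independent of $M$. Suppose Alice sends Bob a single message that is a deterministic function of $M$, and Bob outputs a bit that is a deterministic function of the message and $(u,v)$, such that \[\Pr_{M,u,v}[\text{Bob's output equals } u^{T}Mv]\ \ge\ \frac12+\frac{1}{2^{\sqrt n/8}}.\] Then Alice must communicate at least $n/10$ bits.
   Context: All arithmetic is over $\mathbb{F}_2$; $u^{T}Mv\in\mathbb{F}_2$. The number of bits communicated is the (maximum) length of Alice's message. -}

module Defs where

open import Data.Bool using (Bool; true; false; _∧_; _xor_; if_then_else_)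
open import Data.Bool.Properties using (_≟_)
open import Data.Nat using (ℕ; zero; suc; _+_; _*_; _^_)
open import Data.Fin using (Fin; zero; suc)
open import Data.List using (List; []; _∷_; map; concatMap; foldr; allFin)
open import Data.Nat.ListAction using (sum)
open import Relation.Nullary.Decidable using (does)

-- Vectors and matrices over F₂ (F₂ represented by Bool: xor = +, ∧ = ·).
Vec𝔽₂ : ℕ → Set
Vec𝔽₂ k = Fin k → Bool

Mat𝔽₂ : ℕ → Set
Mat𝔽₂ k = Fin k → Fin k → Bool

Σ𝔽₂ : ∀ k → (Fin k → Bool) → Bool
Σ𝔽₂ k f = foldr _xor_ false (map f (allFin k))

bilin : ∀ {k} → Vec𝔽₂ k → Mat𝔽₂ k → Vec𝔽₂ k → Bool
bilin {k} u M v = Σ𝔽₂ k (λ i → Σ𝔽₂ k (λ j → u i ∧ (M i j ∧ v j)))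

consF : ∀ {A : Set} {k} → A → (Fin k → A) → Fin (suc k) → A
consF a f zero = a
consF a f (suc i) = f i

allFuns : ∀ {A : Set} → List A → ∀ k → List (Fin k → A)
allFuns xs zero = (λ ()) ∷ []
allFuns xs (suc k) = concatMap (λ a → map (consF a) (allFuns xs k)) xs

allBools : List Bool
allBools = false ∷ true ∷ []

allVecs : ∀ k → List (Vec𝔽₂ k)
allVecs k = allFuns allBools k

allMats : ∀ k → List (Mat𝔽₂ k)
allMats k = allFuns (allVecs k) k

successCount : ∀ k → (Mat𝔽₂ k → List Bool)
             → (List Bool → Vec𝔽₂ k → Vec𝔽₂ k → Bool) → ℕ
successCount k alice bob =
  sum (map (λ M → sum (map (λ u → sum (map (λ v →
         if does (bob (alice M) u v ≟ bilin u M v) then 1 else 0)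
       (allVecs k))) (allVecs k))) (allMats k))

totalCount : ℕ → ℕ
totalCount k = 2 ^ (k * k) * 2 ^ k * 2 ^ k

{-# OPTIONS --safe #-}
-- Suppose every message has at most c bits, with 10 c ≤ k².  For the class A of matrices sending
-- a given message, Bob's best correlation is Σ_{u,v} |Σ_{M ∈ A} (-1)^{uᵀMv}|, and by Cauchy–Schwarz
-- its square is at most 2^{2k} Σ_{M,N ∈ A} 2^k |ker (M + N)|.  Now z L^t ≤ L^{t+1} + z^{t+1} splits
-- |ker (M + N)| into a constant L = 2^{k-r} and a (t+1)-st moment of |ker X| over all matrices X.
-- Adding a uniform row to X keeps the kernel K with probability 1/|K| and halves it otherwise, so
-- each row costs a factor 2 while lowering the exponent of the moment by one.  With t = 2k and
-- r = ⌊k/4⌋ the moment, even multiplied by the fewer than 2^{c+1} messages, stays below the constant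
-- term.  A Cauchy–Schwarz inequality weighted by the class sizes |A| then bounds the overall bias
-- by bias² ≤ 2^{1-r}, which contradicts bias ≥ 2 · 2^{-k/8}.
module Submission where

open import Defs
open import Algebra.Bundles using (CommutativeRing)
open import Algebra.Structures using (IsCommutativeSemiring)
open import Data.Bool using (Bool; true; false; _∧_; _xor_; if_then_else_)
import Data.Bool.Properties as 𝔹
open import Data.Fin using (Fin; zero; suc)
open import Data.Integer as ℤ using (ℤ; +_; ∣_∣)
import Data.Integer.Properties as ℤP
import Data.Integer.Tactic.RingSolver as ℤR
open import Data.List using (List; []; _∷_; _++_; map; concatMap; foldr; allFin; length)
open import Data.List.Properties using (map-tabulate)
open import Data.List.Relation.Unary.All as All using (All; []; _∷_)
open import Data.List.Relation.Unary.All.Properties using (¬Any⇒All¬)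
import Data.List.Relation.Unary.Any as Any
open import Data.Nat as ℕ using (ℕ; zero; suc; _+_; _*_; _^_; _∸_; _≤_; _<_; _≤?_; z≤n; s≤s)
open import Data.Nat.DivMod using (_/_; _%_; m≡m%n+[m/n]*n; m%n<n; m/n*n≤m; m*n/n≡m; /-monoˡ-≤)
import Data.Nat.Properties as ℕP
import Data.Nat.Tactic.RingSolver as ℕR
open import Data.Product using (∃; _,_)
open import Data.Sum using (_⊎_; inj₁; inj₂)
open import Function using (_∘_)
open import Relation.Binary.PropositionalEquality
  using (_≡_; refl; sym; trans; cong; cong₂; subst; module ≡-Reasoning)
open import Relation.Nullary using (¬_; yes; no; contradiction)
open import Relation.Nullary.Decidable using (does)

-- Addition of vectors and matrices over F₂.

infixl 6 _⊕_ _⊞_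

_⊕_ : ∀ {k} → Vec𝔽₂ k → Vec𝔽₂ k → Vec𝔽₂ k
(v ⊕ w) i = v i xor w i

_⊞_ : ∀ {k} → Mat𝔽₂ k → Mat𝔽₂ k → Mat𝔽₂ k
(M ⊞ N) i = M i ⊕ N i

-- Finite sums in a commutative semiring.

module Summation {A : Set} {_⊹_ _·_ : A → A → A} {𝟎 𝟏 : A}
  (R : IsCommutativeSemiring _≡_ _⊹_ _·_ 𝟎 𝟏) where

  open IsCommutativeSemiring R
    using (+-assoc; +-comm; +-identityˡ; distribˡ; zeroʳ; *-comm)

  -- The shape `foldr` after `map` is that of `Σ𝔽₂` and of the sums in `successCount`, so the lemmas
  -- below apply to both by definition.
  ∑ : {I : Set} → List I → (I → A) → A
  ∑ xs f = foldr _⊹_ 𝟎 (map f xs)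

  ∑₂ : {I J : Set} → List I → List J → (I → J → A) → A
  ∑₂ xs ys f = ∑ xs (λ i → ∑ ys (f i))

  private variable I J K : Set

  ∑-cong-All : ∀ {xs} {f g : I → A} → All (λ i → f i ≡ g i) xs → ∑ xs f ≡ ∑ xs g
  ∑-cong-All []       = refl
  ∑-cong-All (p ∷ ps) = cong₂ _⊹_ p (∑-cong-All ps)

  ∑-cong : ∀ xs {f g : I → A} → (∀ i → f i ≡ g i) → ∑ xs f ≡ ∑ xs g
  ∑-cong xs p = ∑-cong-All (All.universal p xs)

  ∑₂-cong : ∀ xs ys {f g : I → J → A} → (∀ i j → f i j ≡ g i j) → ∑₂ xs ys f ≡ ∑₂ xs ys g
  ∑₂-cong xs ys p = ∑-cong xs (λ i → ∑-cong ys (p i))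

  ∑-zero : ∀ (xs : List I) → ∑ xs (λ _ → 𝟎) ≡ 𝟎
  ∑-zero []       = refl
  ∑-zero (_ ∷ xs) = trans (+-identityˡ _) (∑-zero xs)

  private
    interchange : ∀ a b c d → (a ⊹ b) ⊹ (c ⊹ d) ≡ (a ⊹ c) ⊹ (b ⊹ d)
    interchange a b c d = begin
      (a ⊹ b) ⊹ (c ⊹ d)  ≡⟨ +-assoc a b _ ⟩
      a ⊹ (b ⊹ (c ⊹ d))  ≡⟨ cong (a ⊹_) (+-assoc b c d) ⟨
      a ⊹ ((b ⊹ c) ⊹ d)  ≡⟨ cong (λ x → a ⊹ (x ⊹ d)) (+-comm b c) ⟩
      a ⊹ ((c ⊹ b) ⊹ d)  ≡⟨ cong (a ⊹_) (+-assoc c b d) ⟩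
      a ⊹ (c ⊹ (b ⊹ d))  ≡⟨ +-assoc a c _ ⟨
      (a ⊹ c) ⊹ (b ⊹ d)  ∎
      where open ≡-Reasoning

  ∑-distrib-+ : ∀ xs (f g : I → A) → ∑ xs (λ i → f i ⊹ g i) ≡ ∑ xs f ⊹ ∑ xs g
  ∑-distrib-+ []       f g = sym (+-identityˡ 𝟎)
  ∑-distrib-+ (x ∷ xs) f g =
    trans (cong ((f x ⊹ g x) ⊹_) (∑-distrib-+ xs f g)) (interchange _ _ _ _)

  *-distribˡ-∑ : ∀ c xs (f : I → A) → c · ∑ xs f ≡ ∑ xs (λ i → c · f i)
  *-distribˡ-∑ c []       f = zeroʳ c
  *-distribˡ-∑ c (x ∷ xs) f = trans (distribˡ c _ _) (cong ((c · f x) ⊹_) (*-distribˡ-∑ c xs f))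

  *-distribʳ-∑ : ∀ c xs (f : I → A) → ∑ xs f · c ≡ ∑ xs (λ i → f i · c)
  *-distribʳ-∑ c xs f = begin
    ∑ xs f · c            ≡⟨ *-comm _ c ⟩
    c · ∑ xs f            ≡⟨ *-distribˡ-∑ c xs f ⟩
    ∑ xs (λ i → c · f i)  ≡⟨ ∑-cong xs (λ i → *-comm c (f i)) ⟩
    ∑ xs (λ i → f i · c)  ∎
    where open ≡-Reasoning

  ∑*∑ : ∀ xs ys (f : I → A) (g : J → A) → ∑ xs f · ∑ ys g ≡ ∑₂ xs ys (λ i j → f i · g j)
  ∑*∑ xs ys f g = trans (*-distribʳ-∑ _ xs f) (∑-cong xs (λ i → *-distribˡ-∑ (f i) ys g))

  *-distribˡ-∑₂ : ∀ c xs ys (f : I → J → A) → c · ∑₂ xs ys f ≡ ∑₂ xs ys (λ i j → c · f i j)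
  *-distribˡ-∑₂ c xs ys f = trans (*-distribˡ-∑ c xs _) (∑-cong xs (λ i → *-distribˡ-∑ c ys (f i)))

  ∑-swap : ∀ xs ys (f : I → J → A) → ∑₂ xs ys f ≡ ∑₂ ys xs (λ j i → f i j)
  ∑-swap []       ys f = sym (∑-zero ys)
  ∑-swap (x ∷ xs) ys f = begin
    ∑ ys (f x) ⊹ ∑₂ xs ys f                        ≡⟨ cong (_ ⊹_) (∑-swap xs ys f) ⟩
    ∑ ys (f x) ⊹ ∑ ys (λ j → ∑ xs (λ i → f i j))   ≡⟨ ∑-distrib-+ ys _ _ ⟨
    ∑₂ ys (x ∷ xs) (λ j i → f i j)                 ∎
    where open ≡-Reasoning

  ∑₂-∑-swap : ∀ xs ys zs (f : I → J → K → A) →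
    ∑₂ xs ys (λ i j → ∑ zs (f i j)) ≡ ∑ zs (λ k → ∑₂ xs ys (λ i j → f i j k))
  ∑₂-∑-swap xs ys zs f =
    trans (∑-cong xs (λ i → ∑-swap ys zs (f i))) (∑-swap xs zs _)

  ∑-++ : ∀ xs ys (f : I → A) → ∑ (xs ++ ys) f ≡ ∑ xs f ⊹ ∑ ys f
  ∑-++ []       ys f = sym (+-identityˡ _)
  ∑-++ (x ∷ xs) ys f = trans (cong (f x ⊹_) (∑-++ xs ys f)) (sym (+-assoc _ _ _))

  ∑-map : ∀ (h : I → J) xs (f : J → A) → ∑ (map h xs) f ≡ ∑ xs (f ∘ h)
  ∑-map h []       f = refl
  ∑-map h (x ∷ xs) f = cong (f (h x) ⊹_) (∑-map h xs f)

  ∑-concatMap-map : ∀ (h : I → J → K) xs ys (f : K → A) →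
    ∑ (concatMap (λ i → map (h i) ys) xs) f ≡ ∑₂ xs ys (λ i j → f (h i j))
  ∑-concatMap-map h []       ys f = refl
  ∑-concatMap-map h (x ∷ xs) ys f = begin
    ∑ (map (h x) ys ++ concatMap (λ i → map (h i) ys) xs) f
      ≡⟨ ∑-++ (map (h x) ys) _ f ⟩
    ∑ (map (h x) ys) f ⊹ ∑ (concatMap (λ i → map (h i) ys) xs) f
      ≡⟨ cong₂ _⊹_ (∑-map (h x) ys f) (∑-concatMap-map h xs ys f) ⟩
    ∑₂ (x ∷ xs) ys (λ i j → f (h i j)) ∎
    where open ≡-Reasoning

  ∑-allFuns-suc : ∀ xs k (f : (Fin (suc k) → I) → A) →
    ∑ (allFuns xs (suc k)) f ≡ ∑₂ xs (allFuns xs k) (λ a g → f (consF a g))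
  ∑-allFuns-suc xs k f = ∑-concatMap-map consF xs (allFuns xs k) f

  ∑-allFin-suc : ∀ k (f : Fin (suc k) → A) → ∑ (allFin (suc k)) f ≡ f zero ⊹ ∑ (allFin k) (f ∘ suc)
  ∑-allFin-suc k f = cong (λ l → f zero ⊹ foldr _⊹_ 𝟎 l)
    (trans (map-tabulate suc f) (sym (map-tabulate (λ i → i) (f ∘ suc))))

  -- Translated functions agree with `consF` expressions only pointwise, so `f` has to respect
  -- pointwise equality. Keeping `_≈_` abstract lets one induction serve vectors, with equal
  -- entries, and matrices, with pointwise equal rows.
  ∑-allFuns-shift : ∀ {xs : List I} {_≈_ : I → I → Set} {_⊕_ : I → I → I} →
    (∀ i → i ≈ i) →
    (∀ i f → (∀ {j j′} → j ≈ j′ → f j ≡ f j′) → ∑ xs (λ j → f (i ⊕ j)) ≡ ∑ xs f) →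
    ∀ k (g : Fin k → I) f → (∀ {h h′} → (∀ i → h i ≈ h′ i) → f h ≡ f h′) →
    ∑ (allFuns xs k) (λ h → f (λ i → g i ⊕ h i)) ≡ ∑ (allFuns xs k) f
  ∑-allFuns-shift ≈-refl shift zero g f f-cong = cong (_⊹ 𝟎) (f-cong (λ ()))
  ∑-allFuns-shift {xs = xs} {_≈_} {_⊕_} ≈-refl shift (suc k) g f f-cong = begin
    ∑ (allFuns xs (suc k)) (λ h → f (λ i → g i ⊕ h i))
      ≡⟨ ∑-allFuns-suc xs k _ ⟩
    ∑₂ xs (allFuns xs k) (λ a h → f (λ i → g i ⊕ consF a h i))
      ≡⟨ ∑₂-cong xs (allFuns xs k) (λ a h → f-cong (cons-⊕ a h)) ⟩
    ∑₂ xs (allFuns xs k) (λ a h → f (consF (g zero ⊕ a) (λ i → g (suc i) ⊕ h i)))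
      ≡⟨ ∑-cong xs (λ a → ∑-allFuns-shift ≈-refl shift k (g ∘ suc) (λ h → f (consF (g zero ⊕ a) h))
           (λ p → f-cong (consF-cong (≈-refl _) p))) ⟩
    ∑ xs (λ a → ∑ (allFuns xs k) (λ h → f (consF (g zero ⊕ a) h)))
      ≡⟨ shift (g zero) (λ a → ∑ (allFuns xs k) (λ h → f (consF a h)))
           (λ p → ∑-cong (allFuns xs k) (λ h → f-cong (consF-cong p (λ i → ≈-refl _)))) ⟩
    ∑₂ xs (allFuns xs k) (λ a h → f (consF a h))
      ≡⟨ ∑-allFuns-suc xs k f ⟨
    ∑ (allFuns xs (suc k)) f ∎
    where
    open ≡-Reasoning
    cons-⊕ : ∀ a h i → (g i ⊕ consF a h i) ≈ consF (g zero ⊕ a) (λ j → g (suc j) ⊕ h j) i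
    cons-⊕ a h zero    = ≈-refl _
    cons-⊕ a h (suc i) = ≈-refl _
    consF-cong : ∀ {a a′ h h′} → a ≈ a′ → (∀ i → h i ≈ h′ i) → ∀ i → consF a h i ≈ consF a′ h′ i
    consF-cong p q zero    = p
    consF-cong p q (suc i) = q i

  ∑-vec-shift : ∀ {k} (v : Vec𝔽₂ k) f → (∀ {w w′} → (∀ i → w i ≡ w′ i) → f w ≡ f w′) →
    ∑ (allVecs k) (λ w → f (v ⊕ w)) ≡ ∑ (allVecs k) f
  ∑-vec-shift {k} = ∑-allFuns-shift {_⊕_ = _xor_} (λ _ → refl) shift k
    where
    shift : ∀ b (f : Bool → A) → (∀ {c c′} → c ≡ c′ → f c ≡ f c′) →
      ∑ allBools (λ c → f (b xor c)) ≡ ∑ allBools f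
    shift false f _ = refl
    shift true  f _ = trans (sym (+-assoc _ _ _)) (trans (cong (_⊹ 𝟎) (+-comm _ _)) (+-assoc _ _ _))

  ∑-mat-shift : ∀ {k} (M : Mat𝔽₂ k) f → (∀ {N N′} → (∀ i j → N i j ≡ N′ i j) → f N ≡ f N′) →
    ∑ (allMats k) (λ N → f (M ⊞ N)) ≡ ∑ (allMats k) f
  ∑-mat-shift {k} = ∑-allFuns-shift {_≈_ = λ v w → ∀ i → v i ≡ w i} {_⊕_ = _⊕_}
    (λ _ _ → refl) ∑-vec-shift k

module Σℕ = Summation ℕP.+-*-isCommutativeSemiring
module Σℤ = Summation ℤP.+-*-isCommutativeSemiring
module Σ𝔹 = Summation (CommutativeRing.isCommutativeSemiring 𝔹.xor-∧-commutativeRing)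

open Σℕ using (∑; ∑₂)
open Σℤ using () renaming (∑ to ∑ᶻ; ∑₂ to ∑₂ᶻ)

-- Sums of numbers, cardinalities, and Cauchy-Schwarz.

^-distribʳ-* : ∀ o m n → (m * n) ^ o ≡ m ^ o * n ^ o
^-distribʳ-* zero    m n = refl
^-distribʳ-* (suc o) m n = begin
  m * n * (m * n) ^ o        ≡⟨ cong (m * n *_) (^-distribʳ-* o m n) ⟩
  m * n * (m ^ o * n ^ o)    ≡⟨ ℕP.[m*n]*[o*p]≡[m*o]*[n*p] m n (m ^ o) (n ^ o) ⟩
  m * m ^ o * (n * n ^ o)    ∎
  where open ≡-Reasoning

∑-mono : ∀ {I : Set} (xs : List I) {f g : I → ℕ} → (∀ i → f i ≤ g i) → ∑ xs f ≤ ∑ xs g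
∑-mono []       p = z≤n
∑-mono (x ∷ xs) p = ℕP.+-mono-≤ (p x) (∑-mono xs p)

∑-const : ∀ {I : Set} (xs : List I) c → ∑ xs (λ _ → c) ≡ length xs * c
∑-const []       c = refl
∑-const (x ∷ xs) c = cong (λ s → c + s) (∑-const xs c)

∑-pos : ∀ {I : Set} (xs : List I) (f : I → ℕ) → + ∑ xs f ≡ ∑ᶻ xs (λ i → + f i)
∑-pos []       f = refl
∑-pos (x ∷ xs) f = trans (ℤP.pos-+ (f x) _) (cong (λ s → + f x ℤ.+ s) (∑-pos xs f))

∑₂-pos : ∀ {I J : Set} (xs : List I) (ys : List J) (f : I → J → ℕ) →
  + ∑₂ xs ys f ≡ ∑₂ᶻ xs ys (λ i j → + f i j)
∑₂-pos xs ys f = trans (∑-pos xs _) (Σℤ.∑-cong xs (λ i → ∑-pos ys (f i)))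

∣∑∣≤∑∣∣ : ∀ {I : Set} (xs : List I) (f : I → ℤ) → ∣ ∑ᶻ xs f ∣ ≤ ∑ xs (λ i → ∣ f i ∣)
∣∑∣≤∑∣∣ []       f = z≤n
∣∑∣≤∑∣∣ (x ∷ xs) f =
  ℕP.≤-trans (ℤP.∣i+j∣≤∣i∣+∣j∣ (f x) _) (ℕP.+-monoʳ-≤ ∣ f x ∣ (∣∑∣≤∑∣∣ xs f))

∑-allFuns-1 : ∀ {I : Set} (xs : List I) k → ∑ (allFuns xs k) (λ _ → 1) ≡ length xs ^ k
∑-allFuns-1 xs zero    = refl
∑-allFuns-1 xs (suc k) = begin
  ∑ (allFuns xs (suc k)) (λ _ → 1)          ≡⟨ Σℕ.∑-allFuns-suc xs k _ ⟩
  ∑ xs (λ _ → ∑ (allFuns xs k) (λ _ → 1))   ≡⟨ Σℕ.∑-cong xs (λ _ → ∑-allFuns-1 xs k) ⟩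
  ∑ xs (λ _ → length xs ^ k)                ≡⟨ ∑-const xs _ ⟩
  length xs * length xs ^ k                 ∎
  where open ≡-Reasoning

length-as-∑ : ∀ {I : Set} (xs : List I) → length xs ≡ ∑ xs (λ _ → 1)
length-as-∑ xs = trans (sym (ℕP.*-identityʳ _)) (sym (∑-const xs 1))

length-allVecs : ∀ k → length (allVecs k) ≡ 2 ^ k
length-allVecs k = trans (length-as-∑ (allVecs k)) (∑-allFuns-1 allBools k)

length-allMats : ∀ k → length (allMats k) ≡ 2 ^ (k * k)
length-allMats k = begin
  length (allMats k)       ≡⟨ length-as-∑ (allMats k) ⟩
  ∑ (allMats k) (λ _ → 1)  ≡⟨ ∑-allFuns-1 (allVecs k) k ⟩
  length (allVecs k) ^ k   ≡⟨ cong (_^ k) (length-allVecs k) ⟩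
  (2 ^ k) ^ k              ≡⟨ ℕP.^-*-assoc 2 k k ⟩
  2 ^ (k * k)              ∎
  where open ≡-Reasoning

-- This follows from 4yz ≤ (y + z)², where the defect is d² for the difference d of y and z.
am-gm : ∀ x y z → x * x ≤ y * z → 2 * x ≤ y + z
am-gm x y z x²≤yz = ℕP.≮⇒≥ λ y+z<2x → ℕP.<-irrefl refl (begin-strict
  4 * (y * z)              ≤⟨ 4yz≤ ⟩
  (y + z) * (y + z)        <⟨ ℕP.*-mono-< y+z<2x y+z<2x ⟩
  2 * x * (2 * x)          ≡⟨ identity x ⟩
  4 * (x * x)              ≤⟨ ℕP.*-monoʳ-≤ 4 x²≤yz ⟩
  4 * (y * z)              ∎)
  where
  open ℕP.≤-Reasoning
  identity : ∀ x → 2 * x * (2 * x) ≡ 4 * (x * x)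
  identity = ℕR.solve-∀
  identity₁ : ∀ y d → 4 * (y * (y + d)) + d * d ≡ (y + (y + d)) * (y + (y + d))
  identity₁ = ℕR.solve-∀
  identity₂ : ∀ z d → 4 * ((z + d) * z) + d * d ≡ ((z + d) + z) * ((z + d) + z)
  identity₂ = ℕR.solve-∀
  4yz≤ : 4 * (y * z) ≤ (y + z) * (y + z)
  4yz≤ with ℕP.≤-total y z
  ... | inj₁ y≤z with d , refl ← ℕP.m≤n⇒∃[o]m+o≡n y≤z =
    subst (4 * (y * (y + d)) ≤_) (identity₁ y d) (ℕP.m≤m+n _ (d * d))
  ... | inj₂ z≤y with d , refl ← ℕP.m≤n⇒∃[o]m+o≡n z≤y =
    subst (4 * ((z + d) * z) ≤_) (identity₂ z d) (ℕP.m≤m+n _ (d * d))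

-- A form free of roots and divisions. In the induction step half the cross term, w b B, has square
-- (w b²)(w B²) ≤ (a c)(A C) = (a C)(A c), so `am-gm` bounds the whole cross term by a C + A c.
∑-Cauchy–Schwarz : ∀ {I : Set} w (xs : List I) (a b c : I → ℕ) →
  (∀ i → w * (b i * b i) ≤ a i * c i) → w * (∑ xs b * ∑ xs b) ≤ ∑ xs a * ∑ xs c
∑-Cauchy–Schwarz w []       a b c p = ℕP.≤-reflexive (ℕP.*-zeroʳ w)
∑-Cauchy–Schwarz w (x ∷ xs) a b c p = begin
  w * ((b x + B) * (b x + B))
    ≡⟨ expand w (b x) B ⟩
  w * (b x * b x) + w * (B * B) + 2 * (w * (b x * B))
    ≤⟨ ℕP.+-mono-≤ (ℕP.+-mono-≤ (p x) ih) (am-gm (w * (b x * B)) (a x * C) (A * c x) cross) ⟩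
  a x * c x + A * C + (a x * C + A * c x)
    ≡⟨ factor (a x) (c x) A C ⟩
  (a x + A) * (c x + C) ∎
  where
  open ℕP.≤-Reasoning
  A = ∑ xs a
  B = ∑ xs b
  C = ∑ xs c
  ih : w * (B * B) ≤ A * C
  ih = ∑-Cauchy–Schwarz w xs a b c p
  expand : ∀ w b B → w * ((b + B) * (b + B)) ≡ w * (b * b) + w * (B * B) + 2 * (w * (b * B))
  expand = ℕR.solve-∀
  factor : ∀ a c A C → a * c + A * C + (a * C + A * c) ≡ (a + A) * (c + C)
  factor = ℕR.solve-∀
  regroup₁ : ∀ w b B → w * (b * B) * (w * (b * B)) ≡ w * (b * b) * (w * (B * B))
  regroup₁ = ℕR.solve-∀
  regroup₂ : ∀ a c A C → a * c * (A * C) ≡ a * C * (A * c)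
  regroup₂ = ℕR.solve-∀
  cross : w * (b x * B) * (w * (b x * B)) ≤ a x * C * (A * c x)
  cross = begin
    w * (b x * B) * (w * (b x * B))      ≡⟨ regroup₁ w (b x) B ⟩
    w * (b x * b x) * (w * (B * B))      ≤⟨ ℕP.*-mono-≤ (p x) ih ⟩
    a x * c x * (A * C)                  ≡⟨ regroup₂ (a x) (c x) A C ⟩
    a x * C * (A * c x)                  ∎

-- The sign character of F₂ and bilinear forms.

χ : Bool → ℤ
χ false = + 1
χ true  = ℤ.- (+ 1)

χ-xor : ∀ a b → χ (a xor b) ≡ χ a ℤ.* χ b
χ-xor false false = refl
χ-xor false true  = refl
χ-xor true  false = refl
χ-xor true  true  = refl

δ : Bool → ℕ
δ false = 1
δ true  = 0

-- The Fourier expansion of the indicator of 0, doubled to remain integral.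
2δ : ∀ b → + (2 * δ b) ≡ + 1 ℤ.+ χ b
2δ false = refl
2δ true  = refl

dot : ∀ {k} → Vec𝔽₂ k → Vec𝔽₂ k → Bool
dot {k} x v = Σ𝔽₂ k (λ i → x i ∧ v i)

dot-cong : ∀ {k} {x x′ v v′ : Vec𝔽₂ k} → (∀ i → x i ≡ x′ i) → (∀ i → v i ≡ v′ i) → dot x v ≡ dot x′ v′
dot-cong {k} p q = Σ𝔹.∑-cong (allFin k) (λ i → cong₂ _∧_ (p i) (q i))

dot-⊕ʳ : ∀ {k} (x v w : Vec𝔽₂ k) → dot x (v ⊕ w) ≡ dot x v xor dot x w
dot-⊕ʳ {k} x v w = trans
  (Σ𝔹.∑-cong (allFin k) (λ i → 𝔹.∧-distribˡ-xor (x i) (v i) (w i)))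
  (Σ𝔹.∑-distrib-+ (allFin k) _ _)

dot-⊕ˡ : ∀ {k} (x y v : Vec𝔽₂ k) → dot (x ⊕ y) v ≡ dot x v xor dot y v
dot-⊕ˡ {k} x y v = trans
  (Σ𝔹.∑-cong (allFin k) (λ i → 𝔹.∧-distribʳ-xor (v i) (x i) (y i)))
  (Σ𝔹.∑-distrib-+ (allFin k) _ _)

dot-consF : ∀ {k} a (x : Vec𝔽₂ k) v → dot (consF a x) v ≡ (a ∧ v zero) xor dot x (v ∘ suc)
dot-consF {k} a x v = Σ𝔹.∑-allFin-suc k (λ i → consF a x i ∧ v i)

_·_ : ∀ {m k} → (Fin m → Vec𝔽₂ k) → Vec𝔽₂ k → Vec𝔽₂ m
(X · v) i = dot (X i) v

bilin-dot : ∀ {k} (u : Vec𝔽₂ k) M v → bilin u M v ≡ dot u (M · v)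
bilin-dot {k} u M v =
  Σ𝔹.∑-cong (allFin k) (λ i → sym (Σ𝔹.*-distribˡ-∑ (u i) (allFin k) (λ j → M i j ∧ v j)))

χ-bilin-⊞ : ∀ {k} (u : Vec𝔽₂ k) M N v → χ (bilin u M v) ℤ.* χ (bilin u N v) ≡ χ (bilin u (M ⊞ N) v)
χ-bilin-⊞ u M N v = begin
  χ (bilin u M v) ℤ.* χ (bilin u N v)     ≡⟨ χ-xor (bilin u M v) (bilin u N v) ⟨
  χ (bilin u M v xor bilin u N v)         ≡⟨ cong χ (cong₂ _xor_ (bilin-dot u M v) (bilin-dot u N v)) ⟩
  χ (dot u (M · v) xor dot u (N · v))     ≡⟨ cong χ (dot-⊕ʳ u (M · v) (N · v)) ⟨
  χ (dot u ((M · v) ⊕ (N · v)))           ≡⟨ cong χ (dot-cong {x = u} (λ _ → refl) (λ i → sym (dot-⊕ˡ (M i) (N i) v))) ⟩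
  χ (dot u ((M ⊞ N) · v))                 ≡⟨ cong χ (bilin-dot u (M ⊞ N) v) ⟨
  χ (bilin u (M ⊞ N) v)                   ∎
  where open ≡-Reasoning

-- The indicator of the zero vector, and kernels over F₂.

vanishes : ∀ {m} → Vec𝔽₂ m → ℕ
vanishes {zero}  y = 1
vanishes {suc m} y = δ (y zero) * vanishes (y ∘ suc)

vanishes-cong : ∀ {m} {y z : Vec𝔽₂ m} → (∀ i → y i ≡ z i) → vanishes y ≡ vanishes z
vanishes-cong {zero}  p = refl
vanishes-cong {suc m} p = cong₂ _*_ (cong δ (p zero)) (vanishes-cong (p ∘ suc))

δ≤1 : ∀ b → δ b ≤ 1
δ≤1 false = ℕP.≤-refl
δ≤1 true  = z≤n

vanishes≤1 : ∀ {m} (y : Vec𝔽₂ m) → vanishes y ≤ 1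
vanishes≤1 {zero}  y = ℕP.≤-refl
vanishes≤1 {suc m} y = ℕP.*-mono-≤ (δ≤1 (y zero)) (vanishes≤1 (y ∘ suc))

-- If `y` is nonzero both sides are 0, and otherwise `y ⊕ z` agrees with `z`.
vanishes-⊕ : ∀ {m} (y z : Vec𝔽₂ m) → vanishes y * vanishes (y ⊕ z) ≡ vanishes y * vanishes z
vanishes-⊕ {zero}  y z = refl
vanishes-⊕ {suc m} y z with y zero
... | true  = refl
... | false = begin
  (1 * a) * (δ (z zero) * vanishes (y′ ⊕ z′))  ≡⟨ lemma a (δ (z zero)) _ ⟩
  δ (z zero) * (a * vanishes (y′ ⊕ z′))        ≡⟨ cong (δ (z zero) *_) (vanishes-⊕ y′ z′) ⟩
  δ (z zero) * (a * vanishes z′)               ≡⟨ lemma a (δ (z zero)) _ ⟨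
  (1 * a) * (δ (z zero) * vanishes z′)         ∎
  where
  open ≡-Reasoning
  y′ = y ∘ suc
  z′ = z ∘ suc
  a  = vanishes y′
  lemma : ∀ a d b → (1 * a) * (d * b) ≡ d * (a * b)
  lemma = ℕR.solve-∀

∑-vanishes : ∀ k → ∑ (allVecs k) vanishes ≡ 1
∑-vanishes zero    = refl
∑-vanishes (suc k) = begin
  ∑ (allVecs (suc k)) vanishes                       ≡⟨ Σℕ.∑-allFuns-suc allBools k vanishes ⟩
  ∑₂ allBools (allVecs k) (λ a v → δ a * vanishes v) ≡⟨ Σℕ.∑*∑ allBools (allVecs k) δ vanishes ⟨
  1 * ∑ (allVecs k) vanishes                         ≡⟨ cong (1 *_) (∑-vanishes k) ⟩
  1                                                  ∎
  where open ≡-Reasoning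

-- Orthogonality of characters: the sum factors over the coordinates, and each contributes 1 +
-- χ(yᵢ), which is twice the indicator of yᵢ = 0.
∑-χ-dot : ∀ {m} (y : Vec𝔽₂ m) → ∑ᶻ (allVecs m) (λ u → χ (dot u y)) ≡ + (2 ^ m * vanishes y)
∑-χ-dot {zero}  y = refl
∑-χ-dot {suc m} y = begin
  ∑ᶻ (allVecs (suc m)) (λ u → χ (dot u y))
    ≡⟨ Σℤ.∑-allFuns-suc allBools m _ ⟩
  ∑₂ᶻ allBools (allVecs m) (λ a u → χ (dot (consF a u) y))
    ≡⟨ Σℤ.∑₂-cong allBools (allVecs m) (λ a u →
         trans (cong χ (dot-consF a u y)) (χ-xor (a ∧ y zero) _)) ⟩
  ∑₂ᶻ allBools (allVecs m) (λ a u → χ (a ∧ y zero) ℤ.* χ (dot u y′))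
    ≡⟨ Σℤ.∑*∑ allBools (allVecs m) (λ a → χ (a ∧ y zero)) (λ u → χ (dot u y′)) ⟨
  (+ 1 ℤ.+ (χ (y zero) ℤ.+ + 0)) ℤ.* ∑ᶻ (allVecs m) (λ u → χ (dot u y′))
    ≡⟨ cong₂ ℤ._*_ (trans (cong (λ s → + 1 ℤ.+ s) (ℤP.+-identityʳ (χ (y zero)))) (sym (2δ (y zero)))) (∑-χ-dot y′) ⟩
  + (2 * δ (y zero)) ℤ.* + (2 ^ m * vanishes y′)
    ≡⟨ ℤP.pos-* (2 * δ (y zero)) _ ⟨
  + ((2 * δ (y zero)) * (2 ^ m * vanishes y′))
    ≡⟨ cong +_ (lemma (δ (y zero)) (2 ^ m) (vanishes y′)) ⟩
  + (2 ^ suc m * vanishes y) ∎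
  where
  open ≡-Reasoning
  y′ = y ∘ suc
  lemma : ∀ d p v → (2 * d) * (p * v) ≡ (2 * p) * (d * v)
  lemma = ℕR.solve-∀

-- The indicator of the kernel. The number of rows is independent of `k` because matrices are later
-- built row by row.
ker : ∀ {m k} → (Fin m → Vec𝔽₂ k) → Vec𝔽₂ k → ℕ
ker X v = vanishes (X · v)

∣ker∣ : ∀ {m k} → (Fin m → Vec𝔽₂ k) → ℕ
∣ker∣ {k = k} X = ∑ (allVecs k) (ker X)

ker-cong : ∀ {m k} {X Y : Fin m → Vec𝔽₂ k} {v w} →
  (∀ i j → X i j ≡ Y i j) → (∀ j → v j ≡ w j) → ker X v ≡ ker Y w
ker-cong p q = vanishes-cong (λ i → dot-cong (p i) q)

ker-⊕ : ∀ {m k} (X : Fin m → Vec𝔽₂ k) v w → ker X v * ker X (v ⊕ w) ≡ ker X v * ker X w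
ker-⊕ X v w = trans
  (cong (ker X v *_) (vanishes-cong (λ i → dot-⊕ʳ (X i) v w)))
  (vanishes-⊕ (X · v) (X · w))

∣ker∣≤ : ∀ {m k} (X : Fin m → Vec𝔽₂ k) → ∣ker∣ X ≤ 2 ^ k
∣ker∣≤ {k = k} X = begin
  ∣ker∣ X                    ≤⟨ ∑-mono (allVecs k) (λ v → vanishes≤1 (X · v)) ⟩
  ∑ (allVecs k) (λ _ → 1)    ≡⟨ ∑-allFuns-1 allBools k ⟩
  2 ^ k                      ∎
  where open ℕP.≤-Reasoning

-- For fixed `v`, the sum over `u` is a character sum that detects X v = 0.
∑-χ-bilin : ∀ {k} (X : Mat𝔽₂ k) →
  ∑₂ᶻ (allVecs k) (allVecs k) (λ u v → χ (bilin u X v)) ≡ + (2 ^ k * ∣ker∣ X)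
∑-χ-bilin {k} X = begin
  ∑₂ᶻ 𝕍 𝕍 (λ u v → χ (bilin u X v))
    ≡⟨ Σℤ.∑-swap 𝕍 𝕍 _ ⟩
  ∑₂ᶻ 𝕍 𝕍 (λ v u → χ (bilin u X v))
    ≡⟨ Σℤ.∑₂-cong 𝕍 𝕍 (λ v u → cong χ (bilin-dot u X v)) ⟩
  ∑₂ᶻ 𝕍 𝕍 (λ v u → χ (dot u (X · v)))
    ≡⟨ Σℤ.∑-cong 𝕍 (λ v → ∑-χ-dot (X · v)) ⟩
  ∑ᶻ 𝕍 (λ v → + (2 ^ k * ker X v))
    ≡⟨ ∑-pos 𝕍 _ ⟨
  + ∑ 𝕍 (λ v → 2 ^ k * ker X v)
    ≡⟨ cong +_ (Σℕ.*-distribˡ-∑ (2 ^ k) 𝕍 (ker X)) ⟨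
  + (2 ^ k * ∣ker∣ X) ∎
  where
  open ≡-Reasoning
  𝕍 = allVecs k

-- The new kernel has size (Z + D)/2, where `D` sums the character given by `x` over the old kernel.
-- Translation invariance gives D² = Z D, so `D` is 0 or `Z`; no dimension theory enters.
∣ker∣-consF : ∀ {m k} (X : Fin m → Vec𝔽₂ k) x →
  2 * ∣ker∣ (consF x X) ≡ ∣ker∣ X ⊎ ∣ker∣ (consF x X) ≡ ∣ker∣ X
∣ker∣-consF {k = k} X x = conclude (ℤP.i*j≡0⇒i≡0∨j≡0 D D*[D-Z])
  where
  open ≡-Reasoning
  𝕍  = allVecs k
  Z  = + ∣ker∣ X
  Z′ = + ∣ker∣ (consF x X)

  κ : Vec𝔽₂ k → ℤ
  κ v = + ker X v

  D : ℤ
  D = ∑ᶻ 𝕍 (λ v → κ v ℤ.* χ (dot x v))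

  2Z′ : + (2 * ∣ker∣ (consF x X)) ≡ Z ℤ.+ D
  2Z′ = begin
    + (2 * ∣ker∣ (consF x X))
      ≡⟨ cong +_ (Σℕ.*-distribˡ-∑ 2 𝕍 (ker (consF x X))) ⟩
    + ∑ 𝕍 (λ v → 2 * (δ (dot x v) * ker X v))
      ≡⟨ ∑-pos 𝕍 _ ⟩
    ∑ᶻ 𝕍 (λ v → + (2 * (δ (dot x v) * ker X v)))
      ≡⟨ Σℤ.∑-cong 𝕍 (λ v → split v) ⟩
    ∑ᶻ 𝕍 (λ v → κ v ℤ.+ κ v ℤ.* χ (dot x v))
      ≡⟨ Σℤ.∑-distrib-+ 𝕍 κ _ ⟩
    ∑ᶻ 𝕍 κ ℤ.+ D
      ≡⟨ cong (λ z → z ℤ.+ D) (∑-pos 𝕍 (ker X)) ⟨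
    Z ℤ.+ D ∎
    where
    lemma : ∀ z c → (+ 1 ℤ.+ c) ℤ.* z ≡ z ℤ.+ z ℤ.* c
    lemma = ℤR.solve-∀
    split : ∀ v → + (2 * (δ (dot x v) * ker X v)) ≡ κ v ℤ.+ κ v ℤ.* χ (dot x v)
    split v = begin
      + (2 * (δ (dot x v) * ker X v))       ≡⟨ cong +_ (ℕP.*-assoc 2 (δ (dot x v)) _) ⟨
      + ((2 * δ (dot x v)) * ker X v)       ≡⟨ ℤP.pos-* (2 * δ (dot x v)) _ ⟩
      + (2 * δ (dot x v)) ℤ.* κ v           ≡⟨ cong (ℤ._* κ v) (2δ (dot x v)) ⟩
      (+ 1 ℤ.+ χ (dot x v)) ℤ.* κ v         ≡⟨ lemma (κ v) (χ (dot x v)) ⟩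
      κ v ℤ.+ κ v ℤ.* χ (dot x v)           ∎

  -- The character sum over the kernel is unchanged by translation by any kernel vector.
  D*D : D ℤ.* D ≡ Z ℤ.* D
  D*D = begin
    D ℤ.* D
      ≡⟨ Σℤ.∑*∑ 𝕍 𝕍 _ _ ⟩
    ∑₂ᶻ 𝕍 𝕍 (λ v w → (κ v ℤ.* χ (dot x v)) ℤ.* (κ w ℤ.* χ (dot x w)))
      ≡⟨ Σℤ.∑₂-cong 𝕍 𝕍 translate ⟩
    ∑₂ᶻ 𝕍 𝕍 (λ v w → κ v ℤ.* (κ (v ⊕ w) ℤ.* χ (dot x (v ⊕ w))))
      ≡⟨ Σℤ.∑-cong 𝕍 (λ v → Σℤ.*-distribˡ-∑ (κ v) 𝕍 _) ⟨
    ∑ᶻ 𝕍 (λ v → κ v ℤ.* ∑ᶻ 𝕍 (λ w → κ (v ⊕ w) ℤ.* χ (dot x (v ⊕ w))))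
      ≡⟨ Σℤ.∑-cong 𝕍 (λ v → cong (κ v ℤ.*_) (Σℤ.∑-vec-shift v (λ w → κ w ℤ.* χ (dot x w)) term-cong)) ⟩
    ∑ᶻ 𝕍 (λ v → κ v ℤ.* D)
      ≡⟨ Σℤ.*-distribʳ-∑ D 𝕍 κ ⟨
    ∑ᶻ 𝕍 κ ℤ.* D
      ≡⟨ cong (ℤ._* D) (∑-pos 𝕍 (ker X)) ⟨
    Z ℤ.* D ∎
    where
    term-cong : ∀ {w w′} → (∀ i → w i ≡ w′ i) → κ w ℤ.* χ (dot x w) ≡ κ w′ ℤ.* χ (dot x w′)
    term-cong p = cong₂ ℤ._*_ (cong +_ (ker-cong {X = X} (λ _ _ → refl) p))
                              (cong χ (dot-cong {x = x} (λ _ → refl) p))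
    lemma₁ : ∀ a b c d → (a ℤ.* c) ℤ.* (b ℤ.* d) ≡ (a ℤ.* b) ℤ.* (c ℤ.* d)
    lemma₁ = ℤR.solve-∀
    translate : ∀ v w → (κ v ℤ.* χ (dot x v)) ℤ.* (κ w ℤ.* χ (dot x w))
                      ≡ κ v ℤ.* (κ (v ⊕ w) ℤ.* χ (dot x (v ⊕ w)))
    translate v w = begin
      (κ v ℤ.* χ (dot x v)) ℤ.* (κ w ℤ.* χ (dot x w))
        ≡⟨ lemma₁ (κ v) (κ w) (χ (dot x v)) (χ (dot x w)) ⟩
      (κ v ℤ.* κ w) ℤ.* (χ (dot x v) ℤ.* χ (dot x w))
        ≡⟨ cong₂ ℤ._*_ (trans (sym (ℤP.pos-* (ker X v) _))
                        (trans (cong +_ (sym (ker-⊕ X v w))) (ℤP.pos-* (ker X v) _)))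
                       (trans (sym (χ-xor (dot x v) (dot x w))) (cong χ (sym (dot-⊕ʳ x v w)))) ⟩
      (κ v ℤ.* κ (v ⊕ w)) ℤ.* χ (dot x (v ⊕ w))
        ≡⟨ ℤP.*-assoc (κ v) (κ (v ⊕ w)) _ ⟩
      κ v ℤ.* (κ (v ⊕ w) ℤ.* χ (dot x (v ⊕ w))) ∎

  D*[D-Z] : D ℤ.* (D ℤ.- Z) ≡ + 0
  D*[D-Z] = trans (lemma D Z) (ℤP.i≡j⇒i-j≡0 D*D)
    where
    lemma : ∀ d z → d ℤ.* (d ℤ.- z) ≡ d ℤ.* d ℤ.- z ℤ.* d
    lemma = ℤR.solve-∀

  conclude : D ≡ + 0 ⊎ D ℤ.- Z ≡ + 0 → _
  conclude (inj₁ D≡0) =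
    inj₁ (ℤP.+-injective (trans 2Z′ (trans (cong (λ d → Z ℤ.+ d) D≡0) (ℤP.+-identityʳ Z))))
  conclude (inj₂ D≡Z) = inj₂ (ℕP.*-cancelˡ-≡ _ _ 2 (ℤP.+-injective (begin
    + (2 * ∣ker∣ (consF x X))  ≡⟨ 2Z′ ⟩
    Z ℤ.+ D                    ≡⟨ cong (λ d → Z ℤ.+ d) (ℤP.i-j≡0⇒i≡j D Z D≡Z) ⟩
    Z ℤ.+ Z                    ≡⟨ ℤP.pos-+ (∣ker∣ X) (∣ker∣ X) ⟨
    + (∣ker∣ X + ∣ker∣ X)      ≡⟨ cong (λ s → + (∣ker∣ X + s)) (ℕP.+-identityʳ (∣ker∣ X)) ⟨
    + (2 * ∣ker∣ X)            ∎)))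

-- Moments of the kernel size of a uniformly random matrix.

∑-δ-dot : ∀ {k} (v : Vec𝔽₂ k) →
  ∑ (allVecs k) (λ x → 2 * δ (dot x v)) ≡ 2 ^ k + 2 ^ k * vanishes v
∑-δ-dot {k} v = ℤP.+-injective (begin
  + ∑ 𝕍 (λ x → 2 * δ (dot x v))
    ≡⟨ ∑-pos 𝕍 _ ⟩
  ∑ᶻ 𝕍 (λ x → + (2 * δ (dot x v)))
    ≡⟨ Σℤ.∑-cong 𝕍 (λ x → 2δ (dot x v)) ⟩
  ∑ᶻ 𝕍 (λ x → + 1 ℤ.+ χ (dot x v))
    ≡⟨ Σℤ.∑-distrib-+ 𝕍 (λ _ → + 1) _ ⟩
  ∑ᶻ 𝕍 (λ _ → + 1) ℤ.+ ∑ᶻ 𝕍 (λ x → χ (dot x v))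
    ≡⟨ cong₂ ℤ._+_ (trans (sym (∑-pos 𝕍 (λ _ → 1))) (cong +_ (∑-allFuns-1 allBools k))) (∑-χ-dot v) ⟩
  + (2 ^ k) ℤ.+ + (2 ^ k * vanishes v)
    ≡⟨ ℤP.pos-+ (2 ^ k) _ ⟨
  + (2 ^ k + 2 ^ k * vanishes v) ∎)
  where
  open ≡-Reasoning
  𝕍 = allVecs k

-- A nonzero kernel vector survives for half of the rows `x`, the zero vector for all of them. Hence
-- the kernel has mean size at most (Z + 1)/2 after a random row.
∑-∣ker∣-consF : ∀ {m k} (X : Fin m → Vec𝔽₂ k) →
  ∑ (allVecs k) (λ x → 2 * ∣ker∣ (consF x X)) ≤ 2 ^ k * ∣ker∣ X + 2 ^ k
∑-∣ker∣-consF {k = k} X = begin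
  ∑ 𝕍 (λ x → 2 * ∣ker∣ (consF x X))
    ≡⟨ Σℕ.∑-cong 𝕍 (λ x → Σℕ.*-distribˡ-∑ 2 𝕍 (ker (consF x X))) ⟩
  ∑₂ 𝕍 𝕍 (λ x v → 2 * (δ (dot x v) * ker X v))
    ≡⟨ Σℕ.∑-swap 𝕍 𝕍 _ ⟩
  ∑₂ 𝕍 𝕍 (λ v x → 2 * (δ (dot x v) * ker X v))
    ≡⟨ Σℕ.∑₂-cong 𝕍 𝕍 (λ v x → sym (ℕP.*-assoc 2 (δ (dot x v)) (ker X v))) ⟩
  ∑₂ 𝕍 𝕍 (λ v x → (2 * δ (dot x v)) * ker X v)
    ≡⟨ Σℕ.∑-cong 𝕍 (λ v → Σℕ.*-distribʳ-∑ (ker X v) 𝕍 _) ⟨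
  ∑ 𝕍 (λ v → ∑ 𝕍 (λ x → 2 * δ (dot x v)) * ker X v)
    ≤⟨ ∑-mono 𝕍 bound ⟩
  ∑ 𝕍 (λ v → 2 ^ k * ker X v + 2 ^ k * vanishes v)
    ≡⟨ Σℕ.∑-distrib-+ 𝕍 _ _ ⟩
  ∑ 𝕍 (λ v → 2 ^ k * ker X v) + ∑ 𝕍 (λ v → 2 ^ k * vanishes v)
    ≡⟨ cong₂ _+_ (Σℕ.*-distribˡ-∑ (2 ^ k) 𝕍 _) (Σℕ.*-distribˡ-∑ (2 ^ k) 𝕍 _) ⟨
  2 ^ k * ∣ker∣ X + 2 ^ k * ∑ 𝕍 vanishes
    ≡⟨ cong (λ s → 2 ^ k * ∣ker∣ X + s) (trans (cong (2 ^ k *_) (∑-vanishes k)) (ℕP.*-identityʳ _)) ⟩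
  2 ^ k * ∣ker∣ X + 2 ^ k ∎
  where
  open ℕP.≤-Reasoning
  𝕍 = allVecs k
  bound : ∀ v → ∑ 𝕍 (λ x → 2 * δ (dot x v)) * ker X v ≤ 2 ^ k * ker X v + 2 ^ k * vanishes v
  bound v = begin
    ∑ 𝕍 (λ x → 2 * δ (dot x v)) * ker X v
      ≡⟨ cong (_* ker X v) (∑-δ-dot v) ⟩
    (2 ^ k + 2 ^ k * vanishes v) * ker X v
      ≡⟨ ℕP.*-distribʳ-+ (ker X v) (2 ^ k) _ ⟩
    2 ^ k * ker X v + 2 ^ k * vanishes v * ker X v
      ≤⟨ ℕP.+-monoʳ-≤ (2 ^ k * ker X v) (ℕP.*-monoʳ-≤ (2 ^ k * vanishes v) (vanishes≤1 (X · v))) ⟩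
    2 ^ k * ker X v + 2 ^ k * vanishes v * 1
      ≡⟨ cong (λ s → 2 ^ k * ker X v + s) (ℕP.*-identityʳ _) ⟩
    2 ^ k * ker X v + 2 ^ k * vanishes v ∎

-- With z ∈ {Z, Z/2}, the power z^(e+1) is bounded by an affine function of z, whose sum is known.
∑-∣ker∣^-consF : ∀ {m k} e (X : Fin m → Vec𝔽₂ k) → k ≤ suc e →
  ∑ (allVecs k) (λ x → ∣ker∣ (consF x X) ^ suc e) ≤ 2 ^ suc k * ∣ker∣ X ^ e
-- The affine bound is z^(e+1) ≤ 2 z Z^e + Z^e - Z^(e+1). Its negative term is carried on the left
-- to avoid subtraction and is cancelled at the end.
∑-∣ker∣^-consF {k = k} e X k≤1+e = ℕP.+-cancelʳ-≤ (2 ^ k * Z ^ suc e) _ _ (begin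
  ∑ 𝕍 (λ x → z x ^ suc e) + 2 ^ k * Z ^ suc e
    ≡⟨ cong (λ s → ∑ 𝕍 (λ x → z x ^ suc e) + s) (const-sum (Z ^ suc e)) ⟨
  ∑ 𝕍 (λ x → z x ^ suc e) + ∑ 𝕍 (λ _ → Z ^ suc e)
    ≡⟨ Σℕ.∑-distrib-+ 𝕍 _ _ ⟨
  ∑ 𝕍 (λ x → z x ^ suc e + Z ^ suc e)
    ≤⟨ ∑-mono 𝕍 (λ x → pointwise x (∣ker∣-consF X x)) ⟩
  ∑ 𝕍 (λ x → 2 * z x * Z ^ e + Z ^ e)
    ≡⟨ Σℕ.∑-distrib-+ 𝕍 _ _ ⟩
  ∑ 𝕍 (λ x → 2 * z x * Z ^ e) + ∑ 𝕍 (λ _ → Z ^ e)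
    ≡⟨ cong₂ _+_ (sym (Σℕ.*-distribʳ-∑ (Z ^ e) 𝕍 _)) (const-sum (Z ^ e)) ⟩
  ∑ 𝕍 (λ x → 2 * z x) * Z ^ e + 2 ^ k * Z ^ e
    ≤⟨ ℕP.+-monoˡ-≤ (2 ^ k * Z ^ e) (ℕP.*-monoˡ-≤ (Z ^ e) (∑-∣ker∣-consF X)) ⟩
  (2 ^ k * Z + 2 ^ k) * Z ^ e + 2 ^ k * Z ^ e
    ≡⟨ lemma (2 ^ k) Z (Z ^ e) ⟩
  2 ^ suc k * Z ^ e + 2 ^ k * Z ^ suc e ∎)
  where
  open ℕP.≤-Reasoning
  𝕍 = allVecs k
  Z = ∣ker∣ X
  z : Vec𝔽₂ k → ℕ
  z x = ∣ker∣ (consF x X)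
  const-sum : ∀ c → ∑ 𝕍 (λ _ → c) ≡ 2 ^ k * c
  const-sum c = trans (∑-const 𝕍 c) (cong (_* c) (length-allVecs k))
  lemma : ∀ p Z y → (p * Z + p) * y + p * y ≡ (2 * p) * y + p * (Z * y)
  lemma = ℕR.solve-∀
  -- Here Z ≤ 2^k ≤ 2^(e+1), so the factor 2^(e+1) gained by halving absorbs one factor `Z`. This is
  -- where k ≤ e + 1 is used.
  halved : ∀ y → 2 * y ≡ Z → y ^ suc e ≤ Z ^ e
  halved y 2y≡Z = ℕP.*-cancelˡ-≤ (2 ^ suc e) {{ℕP.m^n≢0 2 (suc e)}} (begin
    2 ^ suc e * y ^ suc e  ≡⟨ ^-distribʳ-* (suc e) 2 y ⟨
    (2 * y) ^ suc e        ≡⟨ cong (_^ suc e) 2y≡Z ⟩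
    Z * Z ^ e              ≤⟨ ℕP.*-monoˡ-≤ (Z ^ e) (ℕP.≤-trans (∣ker∣≤ X) (ℕP.^-monoʳ-≤ 2 k≤1+e)) ⟩
    2 ^ suc e * Z ^ e      ∎)
  pointwise : ∀ x → 2 * z x ≡ Z ⊎ z x ≡ Z → z x ^ suc e + Z ^ suc e ≤ 2 * z x * Z ^ e + Z ^ e
  pointwise x (inj₁ 2z≡Z) = begin
    z x ^ suc e + Z * Z ^ e    ≤⟨ ℕP.+-monoˡ-≤ (Z * Z ^ e) (halved (z x) 2z≡Z) ⟩
    Z ^ e + Z * Z ^ e          ≡⟨ ℕP.+-comm (Z ^ e) _ ⟩
    Z * Z ^ e + Z ^ e          ≡⟨ cong (λ y → y * Z ^ e + Z ^ e) 2z≡Z ⟨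
    2 * z x * Z ^ e + Z ^ e    ∎
  pointwise x (inj₂ z≡Z) = begin
    z x ^ suc e + Z ^ suc e    ≡⟨ cong (λ y → y ^ suc e + Z ^ suc e) z≡Z ⟩
    Z ^ suc e + Z ^ suc e      ≡⟨ double Z (Z ^ e) ⟩
    2 * Z * Z ^ e              ≤⟨ ℕP.m≤m+n _ (Z ^ e) ⟩
    2 * Z * Z ^ e + Z ^ e      ≡⟨ cong (λ y → 2 * y * Z ^ e + Z ^ e) z≡Z ⟨
    2 * z x * Z ^ e + Z ^ e    ∎
    where
    double : ∀ Z y → Z * y + Z * y ≡ 2 * Z * y
    double = ℕR.solve-∀

-- Each of the `m` rows costs a factor 2^(k+1) and one unit of the exponent. Without rows the kernel
-- is the whole space, leaving (2^k)^e. The condition k ≤ e keeps the exponent high enough at every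
-- step.
∑-∣ker∣^ : ∀ m {k} e → k ≤ e →
  ∑ (allFuns (allVecs k) m) (λ X → ∣ker∣ X ^ (m + e)) ≤ 2 ^ (m * suc k + k * e)
∑-∣ker∣^ zero {k} e k≤e = begin
  ∑ (allVecs k) (λ _ → 1) ^ e + 0   ≡⟨ ℕP.+-identityʳ _ ⟩
  ∑ (allVecs k) (λ _ → 1) ^ e       ≡⟨ cong (_^ e) (∑-allFuns-1 allBools k) ⟩
  (2 ^ k) ^ e                       ≡⟨ ℕP.^-*-assoc 2 k e ⟩
  2 ^ (k * e)                       ∎
  where open ℕP.≤-Reasoning
∑-∣ker∣^ (suc m) {k} e k≤e = begin
  ∑ (allFuns 𝕍 (suc m)) (λ X → ∣ker∣ X ^ suc (m + e))
    ≡⟨ Σℕ.∑-allFuns-suc 𝕍 m _ ⟩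
  ∑₂ 𝕍 (allFuns 𝕍 m) (λ x X → ∣ker∣ (consF x X) ^ suc (m + e))
    ≡⟨ Σℕ.∑-swap 𝕍 (allFuns 𝕍 m) _ ⟩
  ∑₂ (allFuns 𝕍 m) 𝕍 (λ X x → ∣ker∣ (consF x X) ^ suc (m + e))
    ≤⟨ ∑-mono (allFuns 𝕍 m) (λ X → ∑-∣ker∣^-consF (m + e) X
         (ℕP.≤-trans k≤e (ℕP.≤-trans (ℕP.m≤n+m e m) (ℕP.n≤1+n _)))) ⟩
  ∑ (allFuns 𝕍 m) (λ X → 2 ^ suc k * ∣ker∣ X ^ (m + e))
    ≡⟨ Σℕ.*-distribˡ-∑ (2 ^ suc k) (allFuns 𝕍 m) _ ⟨
  2 ^ suc k * ∑ (allFuns 𝕍 m) (λ X → ∣ker∣ X ^ (m + e))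
    ≤⟨ ℕP.*-monoʳ-≤ (2 ^ suc k) (∑-∣ker∣^ m e k≤e) ⟩
  2 ^ suc k * 2 ^ (m * suc k + k * e)
    ≡⟨ ℕP.^-distribˡ-+-* 2 (suc k) _ ⟨
  2 ^ (suc k + (m * suc k + k * e))
    ≡⟨ cong (2 ^_) (ℕP.+-assoc (suc k) (m * suc k) (k * e)) ⟨
  2 ^ (suc m * suc k + k * e) ∎
  where
  open ℕP.≤-Reasoning
  𝕍 = allVecs k

-- Correlations of a class of matrices, the class being given by a weight function.

weight : ∀ k → (Mat𝔽₂ k → ℕ) → ℕ
weight k p = ∑ (allMats k) p

corr : ∀ {k} → (Mat𝔽₂ k → ℕ) → Vec𝔽₂ k → Vec𝔽₂ k → ℤ
corr {k} p u v = ∑ᶻ (allMats k) (λ M → + p M ℤ.* χ (bilin u M v))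

-- The correlation with uᵀMv achieved when Bob answers each (u, v) by the sign of corr p u v.
advantage : ∀ {k} → (Mat𝔽₂ k → ℕ) → ℕ
advantage {k} p = ∑₂ (allVecs k) (allVecs k) (λ u v → ∣ corr p u v ∣)

+∣i∣*∣i∣ : ∀ i → + (∣ i ∣ * ∣ i ∣) ≡ i ℤ.* i
+∣i∣*∣i∣ (+ n)        = ℤP.pos-* n n
+∣i∣*∣i∣ (ℤ.-[1+ n ]) = refl

-- Squaring gives a sum over pairs M, N. The two signs multiply to the sign of the form of M + N,
-- and summing that over `u` and `v` counts its kernel.
∑-corr² : ∀ {k} (p : Mat𝔽₂ k → ℕ) →
  ∑₂ (allVecs k) (allVecs k) (λ u v → ∣ corr p u v ∣ * ∣ corr p u v ∣)
    ≡ 2 ^ k * ∑₂ (allMats k) (allMats k) (λ M N → p M * p N * ∣ker∣ (M ⊞ N))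
∑-corr² {k} p = ℤP.+-injective (begin
  + ∑₂ 𝕍 𝕍 (λ u v → ∣ corr p u v ∣ * ∣ corr p u v ∣)
    ≡⟨ ∑₂-pos 𝕍 𝕍 _ ⟩
  ∑₂ᶻ 𝕍 𝕍 (λ u v → + (∣ corr p u v ∣ * ∣ corr p u v ∣))
    ≡⟨ Σℤ.∑₂-cong 𝕍 𝕍 (λ u v → trans (+∣i∣*∣i∣ (corr p u v)) (Σℤ.∑*∑ 𝕄 𝕄 _ _)) ⟩
  ∑₂ᶻ 𝕍 𝕍 (λ u v → ∑₂ᶻ 𝕄 𝕄 (λ M N →
    (+ p M ℤ.* χ (bilin u M v)) ℤ.* (+ p N ℤ.* χ (bilin u N v))))
    ≡⟨ Σℤ.∑₂-cong 𝕍 𝕍 (λ u v → Σℤ.∑₂-cong 𝕄 𝕄 (λ M N → collect u v M N)) ⟩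
  ∑₂ᶻ 𝕍 𝕍 (λ u v → ∑₂ᶻ 𝕄 𝕄 (λ M N → + (p M * p N) ℤ.* χ (bilin u (M ⊞ N) v)))
    ≡⟨ Σℤ.∑₂-∑-swap 𝕍 𝕍 𝕄 _ ⟩
  ∑ᶻ 𝕄 (λ M → ∑₂ᶻ 𝕍 𝕍 (λ u v → ∑ᶻ 𝕄 (λ N → + (p M * p N) ℤ.* χ (bilin u (M ⊞ N) v))))
    ≡⟨ Σℤ.∑-cong 𝕄 (λ M → Σℤ.∑₂-∑-swap 𝕍 𝕍 𝕄 _) ⟩
  ∑₂ᶻ 𝕄 𝕄 (λ M N → ∑₂ᶻ 𝕍 𝕍 (λ u v → + (p M * p N) ℤ.* χ (bilin u (M ⊞ N) v)))
    ≡⟨ Σℤ.∑₂-cong 𝕄 𝕄 (λ M N → Σℤ.*-distribˡ-∑₂ (+ (p M * p N)) 𝕍 𝕍 _) ⟨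
  ∑₂ᶻ 𝕄 𝕄 (λ M N → + (p M * p N) ℤ.* ∑₂ᶻ 𝕍 𝕍 (λ u v → χ (bilin u (M ⊞ N) v)))
    ≡⟨ Σℤ.∑₂-cong 𝕄 𝕄 (λ M N → trans (cong (+ (p M * p N) ℤ.*_) (∑-χ-bilin (M ⊞ N)))
         (trans (sym (ℤP.pos-* (p M * p N) _)) (cong +_ (regroup (p M * p N) (2 ^ k) _)))) ⟩
  ∑₂ᶻ 𝕄 𝕄 (λ M N → + (2 ^ k * (p M * p N * ∣ker∣ (M ⊞ N))))
    ≡⟨ ∑₂-pos 𝕄 𝕄 _ ⟨
  + ∑₂ 𝕄 𝕄 (λ M N → 2 ^ k * (p M * p N * ∣ker∣ (M ⊞ N)))
    ≡⟨ cong +_ (Σℕ.*-distribˡ-∑₂ (2 ^ k) 𝕄 𝕄 _) ⟨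
  + (2 ^ k * ∑₂ 𝕄 𝕄 (λ M N → p M * p N * ∣ker∣ (M ⊞ N))) ∎)
  where
  open ≡-Reasoning
  𝕍 = allVecs k
  𝕄 = allMats k
  regroup : ∀ a b c → a * (b * c) ≡ b * (a * c)
  regroup = ℕR.solve-∀
  exchange : ∀ a b c d → (a ℤ.* b) ℤ.* (c ℤ.* d) ≡ (a ℤ.* c) ℤ.* (b ℤ.* d)
  exchange = ℤR.solve-∀
  collect : ∀ u v M N → (+ p M ℤ.* χ (bilin u M v)) ℤ.* (+ p N ℤ.* χ (bilin u N v))
                      ≡ + (p M * p N) ℤ.* χ (bilin u (M ⊞ N) v)
  collect u v M N = trans (exchange (+ p M) (χ (bilin u M v)) (+ p N) (χ (bilin u N v)))
    (cong₂ ℤ._*_ (sym (ℤP.pos-* (p M) (p N))) (χ-bilin-⊞ u M N v))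

-- Cauchy-Schwarz against the constant 1, first over `v` and then over `u`.
advantage² : ∀ {k} (p : Mat𝔽₂ k → ℕ) → advantage p * advantage p ≤
  2 ^ k * 2 ^ k * (2 ^ k * ∑₂ (allMats k) (allMats k) (λ M N → p M * p N * ∣ker∣ (M ⊞ N)))
advantage² {k} p = begin
  advantage p * advantage p
    ≡⟨ ℕP.*-identityˡ _ ⟨
  1 * (advantage p * advantage p)
    ≤⟨ ∑-Cauchy–Schwarz 1 𝕍 (λ _ → ∑ 𝕍 (λ _ → 1)) (λ u → ∑ 𝕍 (λ v → ∣ corr p u v ∣))
         (λ u → ∑ 𝕍 (λ v → ∣ corr p u v ∣ * ∣ corr p u v ∣)) (λ u → ℕP.≤-trans (ℕP.≤-reflexive (ℕP.*-identityˡ _)) (inner u)) ⟩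
  ∑₂ 𝕍 𝕍 (λ _ _ → 1) * ∑₂ 𝕍 𝕍 (λ u v → ∣ corr p u v ∣ * ∣ corr p u v ∣)
    ≡⟨ cong₂ _*_ count (∑-corr² p) ⟩
  2 ^ k * 2 ^ k * (2 ^ k * ∑₂ (allMats k) (allMats k) (λ M N → p M * p N * ∣ker∣ (M ⊞ N))) ∎
  where
  open ℕP.≤-Reasoning
  𝕍 = allVecs k
  inner : ∀ u → ∑ 𝕍 (λ v → ∣ corr p u v ∣) * ∑ 𝕍 (λ v → ∣ corr p u v ∣)
    ≤ ∑ 𝕍 (λ _ → 1) * ∑ 𝕍 (λ v → ∣ corr p u v ∣ * ∣ corr p u v ∣)
  inner u = ℕP.≤-trans (ℕP.≤-reflexive (sym (ℕP.*-identityˡ _)))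
    (∑-Cauchy–Schwarz 1 𝕍 (λ _ → 1) (λ v → ∣ corr p u v ∣) _ (λ v → ℕP.≤-refl))
  count : ∑₂ 𝕍 𝕍 (λ _ _ → 1) ≡ 2 ^ k * 2 ^ k
  count = trans (∑-const 𝕍 _) (cong₂ _*_ (length-allVecs k) (∑-allFuns-1 allBools k))

-- The left side is at most max(x, L)^(t+1).
x*L^t≤ : ∀ L t x → L ^ t * x ≤ L ^ suc t + x ^ suc t
x*L^t≤ L t x with ℕP.≤-total x L
... | inj₁ x≤L = begin
  L ^ t * x              ≤⟨ ℕP.*-monoʳ-≤ (L ^ t) x≤L ⟩
  L ^ t * L              ≡⟨ ℕP.*-comm (L ^ t) L ⟩
  L ^ suc t              ≤⟨ ℕP.m≤m+n _ _ ⟩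
  L ^ suc t + x ^ suc t  ∎
  where open ℕP.≤-Reasoning
... | inj₂ L≤x = begin
  L ^ t * x              ≤⟨ ℕP.*-monoˡ-≤ x (ℕP.^-monoˡ-≤ t L≤x) ⟩
  x ^ t * x              ≡⟨ ℕP.*-comm (x ^ t) x ⟩
  x ^ suc t              ≤⟨ ℕP.m≤n+m _ _ ⟩
  L ^ suc t + x ^ suc t  ∎
  where open ℕP.≤-Reasoning

-- The constant part keeps both weights. In the moment part `N` is released to range over all
-- matrices, and translation by `M` turns M + N into an arbitrary matrix.
∑-∣ker∣-⊞ : ∀ {k} L t (p : Mat𝔽₂ k → ℕ) → (∀ M → p M ≤ 1) →
  L ^ t * ∑₂ (allMats k) (allMats k) (λ M N → p M * p N * ∣ker∣ (M ⊞ N))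
    ≤ weight k p * (weight k p * L ^ suc t + ∑ (allMats k) (λ X → ∣ker∣ X ^ suc t))
∑-∣ker∣-⊞ {k} L t p p≤1 = begin
  L ^ t * ∑₂ 𝕄 𝕄 (λ M N → p M * p N * ∣ker∣ (M ⊞ N))
    ≡⟨ Σℕ.*-distribˡ-∑₂ (L ^ t) 𝕄 𝕄 _ ⟩
  ∑₂ 𝕄 𝕄 (λ M N → L ^ t * (p M * p N * ∣ker∣ (M ⊞ N)))
    ≤⟨ ∑-mono 𝕄 (λ M → ∑-mono 𝕄 (pointwise M)) ⟩
  ∑₂ 𝕄 𝕄 (λ M N → p M * (p N * L ^ suc t + ∣ker∣ (M ⊞ N) ^ suc t))
    ≡⟨ Σℕ.∑-cong 𝕄 (λ M → trans (sym (Σℕ.*-distribˡ-∑ (p M) 𝕄 _)) (cong (p M *_) (inner M))) ⟩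
  ∑ 𝕄 (λ M → p M * (weight k p * L ^ suc t + Q))
    ≡⟨ Σℕ.*-distribʳ-∑ _ 𝕄 p ⟨
  weight k p * (weight k p * L ^ suc t + Q) ∎
  where
  open ℕP.≤-Reasoning
  𝕄 = allMats k
  Q = ∑ 𝕄 (λ X → ∣ker∣ X ^ suc t)
  inner : ∀ M → ∑ 𝕄 (λ N → p N * L ^ suc t + ∣ker∣ (M ⊞ N) ^ suc t) ≡ weight k p * L ^ suc t + Q
  inner M = trans (Σℕ.∑-distrib-+ 𝕄 _ _) (cong₂ _+_ (sym (Σℕ.*-distribʳ-∑ (L ^ suc t) 𝕄 p))
    (Σℕ.∑-mat-shift M (λ X → ∣ker∣ X ^ suc t)
      (λ eq → cong (_^ suc t) (Σℕ.∑-cong (allVecs k) (λ v → ker-cong {v = v} eq (λ _ → refl))))))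
  regroup : ∀ w a b z → w * (a * b * z) ≡ a * (b * (w * z))
  regroup = ℕR.solve-∀
  pointwise : ∀ M N → L ^ t * (p M * p N * ∣ker∣ (M ⊞ N))
                    ≤ p M * (p N * L ^ suc t + ∣ker∣ (M ⊞ N) ^ suc t)
  pointwise M N = begin
    L ^ t * (p M * p N * z)                  ≡⟨ regroup (L ^ t) (p M) (p N) z ⟩
    p M * (p N * (L ^ t * z))                ≤⟨ ℕP.*-monoʳ-≤ (p M) (ℕP.*-monoʳ-≤ (p N) (x*L^t≤ L t z)) ⟩
    p M * (p N * (L ^ suc t + z ^ suc t))    ≡⟨ cong (p M *_) (ℕP.*-distribˡ-+ (p N) (L ^ suc t) _) ⟩
    p M * (p N * L ^ suc t + p N * z ^ suc t)
      -- The weight of `N` is dropped in the moment term only.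
      ≤⟨ ℕP.*-monoʳ-≤ (p M) (ℕP.+-monoʳ-≤ (p N * L ^ suc t) (ℕP.*-monoˡ-≤ (z ^ suc t) (p≤1 N))) ⟩
    p M * (p N * L ^ suc t + 1 * z ^ suc t)  ≡⟨ cong (λ y → p M * (p N * L ^ suc t + y)) (ℕP.*-identityˡ _) ⟩
    p M * (p N * L ^ suc t + z ^ suc t)      ∎
    where z = ∣ker∣ (M ⊞ N)

-- The right side is split as the weight times a second factor, which is the hypothesis of
-- `∑-Cauchy–Schwarz` for the later sum over messages.
advantage-bound : ∀ {k} L t (p : Mat𝔽₂ k → ℕ) → (∀ M → p M ≤ 1) →
  L ^ t * (advantage p * advantage p)
    ≤ weight k p * (2 ^ k * 2 ^ k * 2 ^ k * (weight k p * L ^ suc t + ∑ (allMats k) (λ X → ∣ker∣ X ^ suc t)))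
advantage-bound {k} L t p p≤1 = begin
  L ^ t * (advantage p * advantage p)        ≤⟨ ℕP.*-monoʳ-≤ (L ^ t) (advantage² p) ⟩
  L ^ t * (2 ^ k * 2 ^ k * (2 ^ k * E))      ≡⟨ regroup₁ (L ^ t) (2 ^ k) E ⟩
  2 ^ k * 2 ^ k * 2 ^ k * (L ^ t * E)        ≤⟨ ℕP.*-monoʳ-≤ (2 ^ k * 2 ^ k * 2 ^ k) (∑-∣ker∣-⊞ L t p p≤1) ⟩
  2 ^ k * 2 ^ k * 2 ^ k * (weight k p * R)   ≡⟨ regroup₂ (2 ^ k * 2 ^ k * 2 ^ k) (weight k p) R ⟩
  weight k p * (2 ^ k * 2 ^ k * 2 ^ k * R)   ∎
  where
  open ℕP.≤-Reasoning
  E = ∑₂ (allMats k) (allMats k) (λ M N → p M * p N * ∣ker∣ (M ⊞ N))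
  R = weight k p * L ^ suc t + ∑ (allMats k) (λ X → ∣ker∣ X ^ suc t)
  regroup₁ : ∀ w q e → w * (q * q * (q * e)) ≡ q * q * q * (w * e)
  regroup₁ = ℕR.solve-∀
  regroup₂ : ∀ q a r → q * (a * r) ≡ a * (q * r)
  regroup₂ = ℕR.solve-∀

-- Bit strings of length at most `c`, each listed once.

messages : ℕ → List (List Bool)
messages zero    = [] ∷ []
messages (suc c) = [] ∷ concatMap (λ b → map (b ∷_) (messages c)) allBools

same : List Bool → List Bool → ℕ
same []      []      = 1
same []      (_ ∷ _) = 0
same (_ ∷ _) []      = 0
same (a ∷ x) (b ∷ y) = δ (a xor b) * same x y

same≤1 : ∀ x y → same x y ≤ 1
same≤1 []      []      = ℕP.≤-refl
same≤1 []      (_ ∷ _) = z≤n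
same≤1 (_ ∷ _) []      = z≤n
same≤1 (a ∷ x) (b ∷ y) = ℕP.*-mono-≤ (δ≤1 (a xor b)) (same≤1 x y)

∑-messages-1 : ∀ c → ∑ (messages c) (λ _ → 1) < 2 ^ suc c
∑-messages-1 zero    = ℕP.≤-refl
∑-messages-1 (suc c) = begin-strict
  1 + ∑ (concatMap (λ b → map (b ∷_) (messages c)) allBools) (λ _ → 1)
    ≡⟨ cong suc (Σℕ.∑-concatMap-map _∷_ allBools (messages c) (λ _ → 1)) ⟩
  1 + 2 * n
    <⟨ ℕP.≤-reflexive (double n) ⟩
  2 * suc n
    ≤⟨ ℕP.*-monoʳ-≤ 2 (∑-messages-1 c) ⟩
  2 ^ suc (suc c) ∎
  where
  open ℕP.≤-Reasoning
  n = ∑ (messages c) (λ _ → 1)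
  double : ∀ n → suc (1 + 2 * n) ≡ 2 * suc n
  double = ℕR.solve-∀

-- `same` acts as a Kronecker delta, since every string of length at most `c` occurs exactly once in
-- `messages c`.
∑-same : ∀ c x → length x ≤ c → (f : List Bool → ℤ) →
  ∑ᶻ (messages c) (λ m → + same m x ℤ.* f m) ≡ f x
∑-same zero    []      _        f = trans (ℤP.+-identityʳ _) (ℤP.*-identityˡ (f []))
∑-same (suc c) []      _        f = begin
  + 1 ℤ.* f [] ℤ.+ ∑ᶻ (concatMap (λ b → map (b ∷_) (messages c)) allBools) (λ m → + same m [] ℤ.* f m)
    ≡⟨ cong₂ ℤ._+_ (ℤP.*-identityˡ (f [])) (Σℤ.∑-concatMap-map _∷_ allBools (messages c) _) ⟩
  f [] ℤ.+ ∑₂ᶻ allBools (messages c) (λ _ _ → + 0)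
    ≡⟨ cong (λ s → f [] ℤ.+ s) (trans (Σℤ.∑-cong allBools (λ _ → Σℤ.∑-zero (messages c))) (Σℤ.∑-zero allBools)) ⟩
  f [] ℤ.+ + 0
    ≡⟨ ℤP.+-identityʳ (f []) ⟩
  f [] ∎
  where open ≡-Reasoning
∑-same (suc c) (b ∷ x) (s≤s x≤c) f = begin
  + 0 ℤ.+ ∑ᶻ (concatMap (λ a → map (a ∷_) (messages c)) allBools) (λ m → + same m (b ∷ x) ℤ.* f m)
    ≡⟨ ℤP.+-identityˡ _ ⟩
  ∑ᶻ (concatMap (λ a → map (a ∷_) (messages c)) allBools) (λ m → + same m (b ∷ x) ℤ.* f m)
    ≡⟨ Σℤ.∑-concatMap-map _∷_ allBools (messages c) _ ⟩
  ∑₂ᶻ allBools (messages c) (λ a m → + (δ (a xor b) * same m x) ℤ.* f (a ∷ m))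
    ≡⟨ Σℤ.∑-cong allBools (λ a → trans (Σℤ.∑-cong (messages c) (factor a))
         (sym (Σℤ.*-distribˡ-∑ (+ δ (a xor b)) (messages c) _))) ⟩
  ∑ᶻ allBools (λ a → + δ (a xor b) ℤ.* ∑ᶻ (messages c) (λ m → + same m x ℤ.* f (a ∷ m)))
    ≡⟨ Σℤ.∑-cong allBools (λ a → cong (λ s → + δ (a xor b) ℤ.* s) (∑-same c x x≤c (λ m → f (a ∷ m)))) ⟩
  ∑ᶻ allBools (λ a → + δ (a xor b) ℤ.* f (a ∷ x))
    ≡⟨ choose b ⟩
  f (b ∷ x) ∎
  where
  open ≡-Reasoning
  factor : ∀ a m → + (δ (a xor b) * same m x) ℤ.* f (a ∷ m) ≡ + δ (a xor b) ℤ.* (+ same m x ℤ.* f (a ∷ m))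
  factor a m = trans (cong (ℤ._* f (a ∷ m)) (ℤP.pos-* (δ (a xor b)) (same m x)))
                     (ℤP.*-assoc (+ δ (a xor b)) (+ same m x) (f (a ∷ m)))
  left : ∀ y z → + 1 ℤ.* y ℤ.+ (+ 0 ℤ.* z ℤ.+ + 0) ≡ y
  left = ℤR.solve-∀
  right : ∀ y z → + 0 ℤ.* y ℤ.+ (+ 1 ℤ.* z ℤ.+ + 0) ≡ z
  right = ℤR.solve-∀
  choose : ∀ b → ∑ᶻ allBools (λ a → + δ (a xor b) ℤ.* f (a ∷ x)) ≡ f (b ∷ x)
  choose false = left (f (false ∷ x)) (f (true ∷ x))
  choose true  = right (f (false ∷ x)) (f (true ∷ x))

∑-same-1 : ∀ c x → length x ≤ c → ∑ (messages c) (λ m → same m x) ≡ 1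
∑-same-1 c x x≤c = ℤP.+-injective (begin
  + ∑ (messages c) (λ m → same m x)                  ≡⟨ ∑-pos (messages c) _ ⟩
  ∑ᶻ (messages c) (λ m → + same m x)                 ≡⟨ Σℤ.∑-cong (messages c) (λ m → ℤP.*-identityʳ (+ same m x)) ⟨
  ∑ᶻ (messages c) (λ m → + same m x ℤ.* + 1)         ≡⟨ ∑-same c x x≤c (λ _ → + 1) ⟩
  + 1                                                ∎)
  where open ≡-Reasoning

-- The bias of a one-way protocol.

module Protocol {k} (alice : Mat𝔽₂ k → List Bool) (bob : List Bool → Vec𝔽₂ k → Vec𝔽₂ k → Bool) where

  private
    𝕍 = allVecs k
    𝕄 = allMats k

  -- The number of correct answers minus the number of wrong ones, not normalised.
  bias : ℤ
  bias = ∑ᶻ 𝕄 (λ M → ∑₂ᶻ 𝕍 𝕍 (λ u v → χ (bob (alice M) u v) ℤ.* χ (bilin u M v)))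

  sends : List Bool → Mat𝔽₂ k → ℕ
  sends m M = same m (alice M)

  ∑-1≡totalCount : ∑ 𝕄 (λ _ → ∑₂ 𝕍 𝕍 (λ _ _ → 1)) ≡ totalCount k
  ∑-1≡totalCount = begin
    ∑ 𝕄 (λ _ → ∑₂ 𝕍 𝕍 (λ _ _ → 1))   ≡⟨ ∑-const 𝕄 _ ⟩
    length 𝕄 * ∑₂ 𝕍 𝕍 (λ _ _ → 1)    ≡⟨ cong (length 𝕄 *_) (∑-const 𝕍 _) ⟩
    length 𝕄 * (length 𝕍 * ∑ 𝕍 (λ _ → 1))
      ≡⟨ cong₂ _*_ (length-allMats k) (cong₂ _*_ (length-allVecs k) (∑-allFuns-1 allBools k)) ⟩
    2 ^ (k * k) * (2 ^ k * 2 ^ k)    ≡⟨ ℕP.*-assoc (2 ^ (k * k)) (2 ^ k) (2 ^ k) ⟨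
    totalCount k                     ∎
    where open ≡-Reasoning

  successCount≤totalCount : successCount k alice bob ≤ totalCount k
  successCount≤totalCount = ℕP.≤-trans
    (∑-mono 𝕄 λ M → ∑-mono 𝕍 λ u → ∑-mono 𝕍 λ v → indicator≤1 (does (bob (alice M) u v 𝔹.≟ bilin u M v)))
    (ℕP.≤-reflexive ∑-1≡totalCount)
    where
    indicator≤1 : ∀ b → (if b then 1 else 0) ≤ 1
    indicator≤1 true  = ℕP.≤-refl
    indicator≤1 false = z≤n

  2*successCount : + (2 * successCount k alice bob) ≡ + totalCount k ℤ.+ bias
  2*successCount = begin
    + (2 * successCount k alice bob)
      ≡⟨ cong +_ (trans (Σℕ.*-distribˡ-∑ 2 𝕄 _) (Σℕ.∑-cong 𝕄 (λ _ → Σℕ.*-distribˡ-∑₂ 2 𝕍 𝕍 _))) ⟩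
    + ∑ 𝕄 (λ M → ∑₂ 𝕍 𝕍 (λ u v → 2 * hit M u v))
      ≡⟨ trans (∑-pos 𝕄 _) (Σℤ.∑-cong 𝕄 (λ _ → ∑₂-pos 𝕍 𝕍 _)) ⟩
    ∑ᶻ 𝕄 (λ M → ∑₂ᶻ 𝕍 𝕍 (λ u v → + (2 * hit M u v)))
      ≡⟨ Σℤ.∑-cong 𝕄 (λ M → Σℤ.∑₂-cong 𝕍 𝕍 (λ u v → 2hit (bob (alice M) u v) (bilin u M v))) ⟩
    ∑ᶻ 𝕄 (λ M → ∑₂ᶻ 𝕍 𝕍 (λ u v → + 1 ℤ.+ sign M u v))
      ≡⟨ Σℤ.∑-cong 𝕄 (λ M → trans (Σℤ.∑-cong 𝕍 (λ u → Σℤ.∑-distrib-+ 𝕍 _ _)) (Σℤ.∑-distrib-+ 𝕍 _ _)) ⟩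
    ∑ᶻ 𝕄 (λ M → ∑₂ᶻ 𝕍 𝕍 (λ _ _ → + 1) ℤ.+ ∑₂ᶻ 𝕍 𝕍 (sign M))
      ≡⟨ Σℤ.∑-distrib-+ 𝕄 _ _ ⟩
    ∑ᶻ 𝕄 (λ M → ∑₂ᶻ 𝕍 𝕍 (λ _ _ → + 1)) ℤ.+ bias
      ≡⟨ cong (λ s → s ℤ.+ bias) (trans (∑-pos 𝕄 _) (Σℤ.∑-cong 𝕄 (λ _ → ∑₂-pos 𝕍 𝕍 _))) ⟨
    + ∑ 𝕄 (λ _ → ∑₂ 𝕍 𝕍 (λ _ _ → 1)) ℤ.+ bias
      ≡⟨ cong (λ n → + n ℤ.+ bias) ∑-1≡totalCount ⟩
    + totalCount k ℤ.+ bias ∎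
    where
    open ≡-Reasoning
    hit : Mat𝔽₂ k → Vec𝔽₂ k → Vec𝔽₂ k → ℕ
    hit M u v = if does (bob (alice M) u v 𝔹.≟ bilin u M v) then 1 else 0
    sign : Mat𝔽₂ k → Vec𝔽₂ k → Vec𝔽₂ k → ℤ
    sign M u v = χ (bob (alice M) u v) ℤ.* χ (bilin u M v)
    2hit : ∀ a b → + (2 * (if does (a 𝔹.≟ b) then 1 else 0)) ≡ + 1 ℤ.+ χ a ℤ.* χ b
    2hit false false = refl
    2hit false true  = refl
    2hit true  false = refl
    2hit true  true  = refl

  module _ (c : ℕ) (short : All (λ M → length (alice M) ≤ c) 𝕄) where

    -- Inserting the sum of `same m (alice M)` over `m`, which is 1, makes Bob's sign depend on `m`,
    -- `u`, `v` alone, so it leaves the sum over `M`.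
    bias-by-message :
      bias ≡ ∑ᶻ (messages c) (λ m → ∑₂ᶻ 𝕍 𝕍 (λ u v → χ (bob m u v) ℤ.* corr (sends m) u v))
    bias-by-message = begin
      bias
        ≡⟨ Σℤ.∑-cong-All (All.map (λ {M} le → ∑-same c (alice M) le
             (λ m → ∑₂ᶻ 𝕍 𝕍 (λ u v → χ (bob m u v) ℤ.* χ (bilin u M v)))) short) ⟨
      ∑₂ᶻ 𝕄 (messages c) (λ M m → + sends m M ℤ.* ∑₂ᶻ 𝕍 𝕍 (λ u v → χ (bob m u v) ℤ.* χ (bilin u M v)))
        ≡⟨ Σℤ.∑-swap 𝕄 (messages c) _ ⟩
      ∑₂ᶻ (messages c) 𝕄 (λ m M → + sends m M ℤ.* ∑₂ᶻ 𝕍 𝕍 (λ u v → χ (bob m u v) ℤ.* χ (bilin u M v)))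
        ≡⟨ Σℤ.∑₂-cong (messages c) 𝕄 (λ m M → trans (Σℤ.*-distribˡ-∑₂ (+ sends m M) 𝕍 𝕍 _)
             (Σℤ.∑₂-cong 𝕍 𝕍 (λ u v → exchange (+ sends m M) (χ (bob m u v)) (χ (bilin u M v))))) ⟩
      ∑₂ᶻ (messages c) 𝕄 (λ m M → ∑₂ᶻ 𝕍 𝕍 (λ u v → χ (bob m u v) ℤ.* (+ sends m M ℤ.* χ (bilin u M v))))
        ≡⟨ Σℤ.∑-cong (messages c) (λ m → Σℤ.∑₂-∑-swap 𝕍 𝕍 𝕄 _) ⟨
      ∑ᶻ (messages c) (λ m → ∑₂ᶻ 𝕍 𝕍 (λ u v → ∑ᶻ 𝕄 (λ M → χ (bob m u v) ℤ.* (+ sends m M ℤ.* χ (bilin u M v)))))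
        ≡⟨ Σℤ.∑-cong (messages c) (λ m → Σℤ.∑₂-cong 𝕍 𝕍 (λ u v → Σℤ.*-distribˡ-∑ (χ (bob m u v)) 𝕄 _)) ⟨
      ∑ᶻ (messages c) (λ m → ∑₂ᶻ 𝕍 𝕍 (λ u v → χ (bob m u v) ℤ.* corr (sends m) u v)) ∎
      where
      open ≡-Reasoning
      exchange : ∀ x y z → x ℤ.* (y ℤ.* z) ≡ y ℤ.* (x ℤ.* z)
      exchange = ℤR.solve-∀

    ∣bias∣≤ : ∣ bias ∣ ≤ ∑ (messages c) (λ m → advantage (sends m))
    ∣bias∣≤ = begin
      ∣ bias ∣
        ≡⟨ cong ∣_∣ bias-by-message ⟩
      ∣ ∑ᶻ (messages c) (λ m → ∑₂ᶻ 𝕍 𝕍 (λ u v → χ (bob m u v) ℤ.* corr (sends m) u v)) ∣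
        ≤⟨ ∣∑∣≤∑∣∣ (messages c) _ ⟩
      ∑ (messages c) (λ m → ∣ ∑₂ᶻ 𝕍 𝕍 (λ u v → χ (bob m u v) ℤ.* corr (sends m) u v) ∣)
        ≤⟨ ∑-mono (messages c) (λ m → ℕP.≤-trans (∣∑∣≤∑∣∣ 𝕍 _) (∑-mono 𝕍 (λ u → ∣∑∣≤∑∣∣ 𝕍 _))) ⟩
      ∑ (messages c) (λ m → ∑₂ 𝕍 𝕍 (λ u v → ∣ χ (bob m u v) ℤ.* corr (sends m) u v ∣))
        ≡⟨ Σℕ.∑-cong (messages c) (λ m → Σℕ.∑₂-cong 𝕍 𝕍 (λ u v → ∣χ*∣ (bob m u v) (corr (sends m) u v))) ⟩
      ∑ (messages c) (λ m → advantage (sends m)) ∎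
      where
      open ℕP.≤-Reasoning
      ∣χ*∣ : ∀ b i → ∣ χ b ℤ.* i ∣ ≡ ∣ i ∣
      ∣χ*∣ false i = cong ∣_∣ (ℤP.*-identityˡ i)
      ∣χ*∣ true  i = trans (cong ∣_∣ (ℤP.-1*i≡-i i)) (ℤP.∣-i∣≡∣i∣ i)

    ∑-weight : ∑ (messages c) (λ m → weight k (sends m)) ≡ 2 ^ (k * k)
    ∑-weight = begin
      ∑₂ (messages c) 𝕄 sends             ≡⟨ Σℕ.∑-swap (messages c) 𝕄 sends ⟩
      ∑₂ 𝕄 (messages c) (λ M m → sends m M)
        ≡⟨ Σℕ.∑-cong-All (All.map (λ {M} le → ∑-same-1 c (alice M) le) short) ⟩
      ∑ 𝕄 (λ _ → 1)                       ≡⟨ length-as-∑ 𝕄 ⟨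
      length 𝕄                            ≡⟨ length-allMats k ⟩
      2 ^ (k * k)                         ∎
      where open ≡-Reasoning

    -- Cauchy-Schwarz is weighted by the class sizes, which add up to the number of matrices. The
    -- number of messages therefore multiplies the moment term only.
    bias² : ∀ L t → L ^ t * (∣ bias ∣ * ∣ bias ∣) ≤ 2 ^ (k * k) * (2 ^ k * 2 ^ k * 2 ^ k *
      (2 ^ (k * k) * L ^ suc t + 2 ^ suc c * ∑ 𝕄 (λ X → ∣ker∣ X ^ suc t)))
    bias² L t = begin
      L ^ t * (∣ bias ∣ * ∣ bias ∣)
        ≤⟨ ℕP.*-monoʳ-≤ (L ^ t) (ℕP.*-mono-≤ ∣bias∣≤ ∣bias∣≤) ⟩
      L ^ t * (∑ ms (λ m → advantage (sends m)) * ∑ ms (λ m → advantage (sends m)))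
        ≤⟨ ∑-Cauchy–Schwarz (L ^ t) ms a (λ m → advantage (sends m)) (λ m → q * (a m * L ^ suc t + Q))
             (λ m → advantage-bound L t (sends m) (λ M → same≤1 m (alice M))) ⟩
      ∑ ms a * ∑ ms (λ m → q * (a m * L ^ suc t + Q))
        ≡⟨ cong₂ _*_ ∑-weight (sym (Σℕ.*-distribˡ-∑ q ms _)) ⟩
      2 ^ (k * k) * (q * ∑ ms (λ m → a m * L ^ suc t + Q))
        ≡⟨ cong (λ s → 2 ^ (k * k) * (q * s)) (Σℕ.∑-distrib-+ ms _ _) ⟩
      2 ^ (k * k) * (q * (∑ ms (λ m → a m * L ^ suc t) + ∑ ms (λ _ → Q)))
        ≡⟨ cong (λ s → 2 ^ (k * k) * (q * (s + ∑ ms (λ _ → Q))))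
             (trans (sym (Σℕ.*-distribʳ-∑ (L ^ suc t) ms a)) (cong (_* L ^ suc t) ∑-weight)) ⟩
      2 ^ (k * k) * (q * (2 ^ (k * k) * L ^ suc t + ∑ ms (λ _ → Q)))
        ≤⟨ ℕP.*-monoʳ-≤ (2 ^ (k * k)) (ℕP.*-monoʳ-≤ q (ℕP.+-monoʳ-≤ (2 ^ (k * k) * L ^ suc t) count)) ⟩
      2 ^ (k * k) * (q * (2 ^ (k * k) * L ^ suc t + 2 ^ suc c * Q)) ∎
      where
      open ℕP.≤-Reasoning
      ms = messages c
      q  = 2 ^ k * 2 ^ k * 2 ^ k
      Q  = ∑ 𝕄 (λ X → ∣ker∣ X ^ suc t)
      a  : List Bool → ℕ
      a m = weight k (sends m)
      count : ∑ ms (λ _ → Q) ≤ 2 ^ suc c * Q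
      count = begin
        ∑ ms (λ _ → Q)           ≡⟨ ∑-const ms Q ⟩
        length ms * Q            ≡⟨ cong (_* Q) (length-as-∑ ms) ⟩
        ∑ ms (λ _ → 1) * Q       ≤⟨ ℕP.*-monoˡ-≤ Q (ℕP.<⇒≤ (∑-messages-1 c)) ⟩
        2 ^ suc c * Q            ∎

-- Choice of parameters: r = q + 1, k = 4r + ρ, L = 2^(k-r), t = 2k.

noise-exponent : ∀ q ρ c →
  let s = suc q; k = s * 4 + ρ; l = s * 3 + ρ in
  10 * c ≤ k * k → suc c + (k * suc k + k * suc k) ≤ k * k + l * suc (k + k)
noise-exponent q ρ c 10c≤k² = ℕP.*-cancelˡ-≤ 10 (begin
  10 * (suc c + (k * suc k + k * suc k))
    ≡⟨ expand c k ⟩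
  10 * c + (10 + 20 * (k * suc k))
    ≤⟨ ℕP.+-monoˡ-≤ (10 + 20 * (k * suc k)) 10c≤k² ⟩
  k * k + (10 + 20 * (k * suc k))
    -- The exact difference of the two sides. Its coefficients are nonnegative because `s` is at
    -- least 1; at s = 0 and ρ = 0 the difference would be -10.
    ≤⟨ ℕP.m≤m+n _ (4 + 78 * q + 64 * (q * q) + 42 * ρ + 52 * (q * ρ) + 9 * (ρ * ρ)) ⟩
  k * k + (10 + 20 * (k * suc k)) + (4 + 78 * q + 64 * (q * q) + 42 * ρ + 52 * (q * ρ) + 9 * (ρ * ρ))
    ≡⟨ slack q ρ ⟩
  10 * (k * k + l * suc (k + k)) ∎)
  where
  open ℕP.≤-Reasoning
  s = suc q
  k = s * 4 + ρ
  l = s * 3 + ρ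
  expand : ∀ c k → 10 * (suc c + (k * suc k + k * suc k)) ≡ 10 * c + (10 + 20 * (k * suc k))
  expand = ℕR.solve-∀
  slack : ∀ q ρ → (suc q * 4 + ρ) * (suc q * 4 + ρ) + (10 + 20 * ((suc q * 4 + ρ) * suc (suc q * 4 + ρ)))
                  + (4 + 78 * q + 64 * (q * q) + 42 * ρ + 52 * (q * ρ) + 9 * (ρ * ρ))
                ≡ 10 * ((suc q * 4 + ρ) * (suc q * 4 + ρ)
                  + (suc q * 3 + ρ) * suc ((suc q * 4 + ρ) + (suc q * 4 + ρ)))
  slack = ℕR.solve-∀

noise-bound : ∀ q ρ c →
  let k = suc q * 4 + ρ; l = suc q * 3 + ρ in
  10 * c ≤ k * k →
  2 ^ suc c * ∑ (allMats k) (λ X → ∣ker∣ X ^ suc (k + k)) ≤ 2 ^ (k * k) * (2 ^ l) ^ suc (k + k)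
noise-bound q ρ c 10c≤k² = begin
  2 ^ suc c * ∑ (allMats k) (λ X → ∣ker∣ X ^ suc (k + k))
    ≤⟨ ℕP.*-monoʳ-≤ (2 ^ suc c) moment ⟩
  2 ^ suc c * 2 ^ (k * suc k + k * suc k)
    ≡⟨ ℕP.^-distribˡ-+-* 2 (suc c) _ ⟨
  2 ^ (suc c + (k * suc k + k * suc k))
    ≤⟨ ℕP.^-monoʳ-≤ 2 (noise-exponent q ρ c 10c≤k²) ⟩
  2 ^ (k * k + l * suc (k + k))
    ≡⟨ ℕP.^-distribˡ-+-* 2 (k * k) _ ⟩
  2 ^ (k * k) * 2 ^ (l * suc (k + k))
    ≡⟨ cong (2 ^ (k * k) *_) (ℕP.^-*-assoc 2 l (suc (k + k))) ⟨
  2 ^ (k * k) * (2 ^ l) ^ suc (k + k) ∎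
  where
  open ℕP.≤-Reasoning
  k = suc q * 4 + ρ
  l = suc q * 3 + ρ
  moment : ∑ (allMats k) (λ X → ∣ker∣ X ^ suc (k + k)) ≤ 2 ^ (k * suc k + k * suc k)
  -- The exponent 2k + 1 is split as `k` rows plus a remaining exponent e = k + 1, which satisfies k
  -- ≤ e.
  moment = subst (λ t → ∑ (allMats k) (λ X → ∣ker∣ X ^ t) ≤ 2 ^ (k * suc k + k * suc k))
    (ℕP.+-suc k k) (∑-∣ker∣^ k (suc k) (ℕP.n≤1+n k))

short⇒small-bias : ∀ q ρ c → let k = suc q * 4 + ρ in 10 * c ≤ k * k →
  ∀ alice bob → let open Protocol {k} alice bob in
  All (λ M → length (alice M) ≤ c) (allMats k) →
  2 ^ suc q * (∣ bias ∣ * ∣ bias ∣) ≤ 2 * (totalCount k * totalCount k)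
short⇒small-bias q ρ c 10c≤k² alice bob short = begin
  R * (β * β)              ≤⟨ ℕP.*-monoʳ-≤ R β²≤ ⟩
  R * (2 * (N * N * P * L)) ≡⟨ regroup₁ R N P L ⟩
  2 * (N * N * P * (R * L)) ≡⟨ cong (λ x → 2 * (N * N * P * x)) R*L ⟩
  2 * (N * N * P * 2 ^ k)   ≡⟨ regroup₂ N (2 ^ k) ⟩
  2 * (totalCount k * totalCount k) ∎
  where
  open ℕP.≤-Reasoning
  k = suc q * 4 + ρ
  l = suc q * 3 + ρ
  t = k + k
  β = ∣ Protocol.bias alice bob ∣
  N = 2 ^ (k * k)
  P = 2 ^ k * 2 ^ k * 2 ^ k
  R = 2 ^ suc q
  L = 2 ^ l
  regroup₁ : ∀ R N P L → R * (2 * (N * N * P * L)) ≡ 2 * (N * N * P * (R * L))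
  regroup₁ = ℕR.solve-∀
  regroup₂ : ∀ N p → 2 * (N * N * (p * p * p) * p) ≡ 2 * (N * p * p * (N * p * p))
  regroup₂ = ℕR.solve-∀
  regroup₃ : ∀ N P L w → N * (P * (N * (L * w) + N * (L * w))) ≡ w * (2 * (N * N * P * L))
  regroup₃ = ℕR.solve-∀
  exponents : ∀ q ρ → suc q + (suc q * 3 + ρ) ≡ suc q * 4 + ρ
  exponents = ℕR.solve-∀
  R*L : R * L ≡ 2 ^ k
  R*L = trans (sym (ℕP.^-distribˡ-+-* 2 (suc q) l)) (cong (2 ^_) (exponents q ρ))
  β²≤ : β * β ≤ 2 * (N * N * P * L)
  -- The moment term is at most the constant term, hence the factor 2. Both contain L^t, which
  -- cancels.
  β²≤ = ℕP.*-cancelˡ-≤ (L ^ t) {{ℕP.m^n≢0 L t {{ℕP.m^n≢0 2 l}}}} (begin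
    L ^ t * (β * β)
      ≤⟨ Protocol.bias² alice bob c short L t ⟩
    N * (P * (N * L ^ suc t + 2 ^ suc c * ∑ (allMats k) (λ X → ∣ker∣ X ^ suc t)))
      ≤⟨ ℕP.*-monoʳ-≤ N (ℕP.*-monoʳ-≤ P (ℕP.+-monoʳ-≤ (N * L ^ suc t) (noise-bound q ρ c 10c≤k²))) ⟩
    N * (P * (N * L ^ suc t + N * L ^ suc t))
      ≡⟨ regroup₃ N P L (L ^ t) ⟩
    L ^ t * (2 * (N * N * P * L)) ∎)

-- From small bias to small success probability.

small-bias⇒< : ∀ r k β T → 0 < T → k ≤ 3 + 4 * r →
  2 ^ r * (β * β) ≤ 2 * (T * T) → β ^ 8 * 2 ^ k < (2 * T) ^ 8
small-bias⇒< r k β T 0<T k≤3+4r h = begin-strict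
  -- The hypothesis is raised to the fourth power. Rounding k/4 down loses at most a factor 2³ = 8,
  -- and (2T)^8 = 16 (2T²)^4 leaves room for it with strict inequality.
  β ^ 8 * 2 ^ k                   ≤⟨ ℕP.*-monoʳ-≤ (β ^ 8) (ℕP.^-monoʳ-≤ 2 k≤3+4r) ⟩
  β ^ 8 * 2 ^ (3 + 4 * r)         ≡⟨ cong (β ^ 8 *_) split ⟩
  β ^ 8 * (8 * (2 ^ r) ^ 4)       ≡⟨ regroup₁ (2 ^ r) β ⟩
  8 * (2 ^ r * (β * β)) ^ 4       ≤⟨ ℕP.*-monoʳ-≤ 8 (ℕP.^-monoˡ-≤ 4 h) ⟩
  8 * (2 * (T * T)) ^ 4           <⟨ ℕP.*-monoˡ-< ((2 * (T * T)) ^ 4) {{nz}} 8<16 ⟩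
  16 * (2 * (T * T)) ^ 4          ≡⟨ regroup₂ T ⟩
  (2 * T) ^ 8                     ∎
  where
  open ℕP.≤-Reasoning
  instance
    T≢0 = ℕ.>-nonZero 0<T
  nz : ℕ.NonZero ((2 * (T * T)) ^ 4)
  nz = ℕP.m^n≢0 (2 * (T * T)) 4 {{ℕP.m*n≢0 2 (T * T) {{_}} {{ℕP.m*n≢0 T T}}}}
  8<16 : 8 < 16
  8<16 = ℕP.m≤m+n 9 7
  split : 2 ^ (3 + 4 * r) ≡ 8 * (2 ^ r) ^ 4
  split = trans (ℕP.^-distribˡ-+-* 2 3 (4 * r))
    (cong (8 *_) (trans (cong (2 ^_) (ℕP.*-comm 4 r)) (sym (ℕP.^-*-assoc 2 r 4))))
  ^8≡ : ∀ b → b ^ 8 ≡ (b * b) ^ 4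
  ^8≡ b = trans (ℕP.^-distribˡ-+-* b 4 4) (sym (^-distribʳ-* 4 b b))
  commute : ∀ x z → x * (8 * z) ≡ 8 * (z * x)
  commute = ℕR.solve-∀
  regroup₁ : ∀ y b → b ^ 8 * (8 * y ^ 4) ≡ 8 * (y * (b * b)) ^ 4
  regroup₁ y b = trans (cong (_* (8 * y ^ 4)) (^8≡ b))
    (trans (commute ((b * b) ^ 4) (y ^ 4)) (cong (8 *_) (sym (^-distribʳ-* 4 y (b * b)))))
  square : ∀ T → 2 * (2 * (T * T)) ≡ 2 * T * (2 * T)
  square = ℕR.solve-∀
  regroup₂ : ∀ T → 16 * (2 * (T * T)) ^ 4 ≡ (2 * T) ^ 8
  regroup₂ T = trans (sym (^-distribʳ-* 4 2 (2 * (T * T))))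
    (trans (cong (_^ 4) (square T)) (sym (^8≡ (2 * T))))

-- The bias bound is applied with r = ⌊k/4⌋. Since T ≤ 2S, the truncated difference 2S - T is
-- exactly the absolute value of the bias.
short⇒small-success : ∀ k c → 10 * c ≤ k * k → (alice : Mat𝔽₂ k → List Bool) →
  (bob : List Bool → Vec𝔽₂ k → Vec𝔽₂ k → Bool) →
  totalCount k ≤ 2 * successCount k alice bob →
  All (λ M → length (alice M) ≤ c) (allMats k) →
  (2 * successCount k alice bob ∸ totalCount k) ^ 8 * 2 ^ k < (2 * totalCount k) ^ 8
short⇒small-success k c 10c≤k² alice bob T≤2S short =
  small-bias⇒< (k / 4) k (2 * S ∸ T) T 0<T k≤ (bound (k / 4) (k % 4) (m≡m%n+[m/n]*n k 4))
  where
  open Protocol alice bob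
  S = successCount k alice bob
  T = totalCount k
  0<T : 0 < T
  0<T = ℕP.*-mono-< (ℕP.*-mono-< (ℕP.m^n>0 2 (k * k)) (ℕP.m^n>0 2 k)) (ℕP.m^n>0 2 k)
  k≤ : k ≤ 3 + 4 * (k / 4)
  k≤ = begin
    k                  ≡⟨ m≡m%n+[m/n]*n k 4 ⟩
    k % 4 + k / 4 * 4  ≤⟨ ℕP.+-monoˡ-≤ (k / 4 * 4) (ℕP.≤-pred (m%n<n k 4)) ⟩
    3 + k / 4 * 4      ≡⟨ cong (λ x → 3 + x) (ℕP.*-comm (k / 4) 4) ⟩
    3 + 4 * (k / 4)    ∎
    where open ℕP.≤-Reasoning
  ∣bias∣≡ : ∣ bias ∣ ≡ 2 * S ∸ T
  ∣bias∣≡ = cong ∣_∣ (begin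
    bias                           ≡⟨ cancel (+ T) bias ⟩
    (+ T ℤ.+ bias) ℤ.- + T         ≡⟨ cong (ℤ._- + T) 2*successCount ⟨
    + (2 * S) ℤ.- + T              ≡⟨ ℤP.m-n≡m⊖n (2 * S) T ⟩
    2 * S ℤ.⊖ T                    ≡⟨ ℤP.⊖-≥ T≤2S ⟩
    + (2 * S ∸ T)                  ∎)
    where
    open ≡-Reasoning
    cancel : ∀ t b → b ≡ (t ℤ.+ b) ℤ.- t
    cancel = ℤR.solve-∀
  bound : ∀ r ρ → k ≡ ρ + r * 4 → 2 ^ r * ((2 * S ∸ T) * (2 * S ∸ T)) ≤ 2 * (T * T)
  bound zero    ρ _  = ℕP.*-mono-≤ (ℕP.n≤1+n 1) (ℕP.*-mono-≤ 2S∸T≤T 2S∸T≤T)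
    where
    2S∸T≤T : 2 * S ∸ T ≤ T
    2S∸T≤T = begin
      2 * S ∸ T       ≤⟨ ℕP.∸-monoˡ-≤ T (ℕP.*-monoʳ-≤ 2 successCount≤totalCount) ⟩
      T + (T + 0) ∸ T ≡⟨ ℕP.m+n∸m≡n T (T + 0) ⟩
      T + 0           ≡⟨ ℕP.+-identityʳ T ⟩
      T               ∎
      where open ℕP.≤-Reasoning
  bound (suc q) ρ k≡ = subst (λ b → 2 ^ suc q * (b * b) ≤ 2 * (T * T)) ∣bias∣≡
    (rebase (trans k≡ (ℕP.+-comm ρ _)) 10c≤k² alice bob short)
    where
    -- The types of `alice` and `bob` depend on `k`; generalising over all three allows the equation
    -- to be matched with `refl`.
    rebase : ∀ {k} → k ≡ suc q * 4 + ρ → 10 * c ≤ k * k → ∀ alice bob →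
      All (λ M → length (alice M) ≤ c) (allMats k) →
      2 ^ suc q * (∣ Protocol.bias {k} alice bob ∣ * ∣ Protocol.bias {k} alice bob ∣)
        ≤ 2 * (totalCount k * totalCount k)
    rebase refl = short⇒small-bias q ρ c

-- With S successes among T inputs, S/T ≥ 1/2 + 2^(-k/8) means 2S - T ≥ 2T 2^(-k/8). The eighth
-- power removes the fractional exponent, and T ≤ 2S makes the truncated subtraction exact.
theorem4p1 : (n k : ℕ) → n ≡ k * k
    → (alice : Mat𝔽₂ k → List Bool)
    → (bob : List Bool → Vec𝔽₂ k → Vec𝔽₂ k → Bool)
    → totalCount k ≤ 2 * successCount k alice bob
    → (2 * totalCount k) ^ 8 ≤ (2 * successCount k alice bob ∸ totalCount k) ^ 8 * 2 ^ k
    → ∃ λ (M : Mat𝔽₂ k) → n ≤ 10 * length (alice M)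
theorem4p1 n k refl alice bob T≤2S h
  -- A decidable search through the enumerated matrices replaces excluded middle. If it fails, all
  -- enumerated messages are short, and all the sums range over that list.
  with Any.any? (λ M → k * k ≤? 10 * length (alice M)) (allMats k)
... | yes long = Any.satisfied long
... | no ¬long = contradiction h (ℕP.<⇒≱
    (short⇒small-success k c 10c≤k² alice bob T≤2S (All.map fits (¬Any⇒All¬ _ ¬long))))
  where
  -- The largest integer with 10 c ≤ k²; a message with 10 times its length below k² has at most
  -- this many bits.
  c = k * k / 10
  10c≤k² : 10 * c ≤ k * k
  10c≤k² = subst (_≤ k * k) (ℕP.*-comm c 10) (m/n*n≤m (k * k) 10)
  fits : ∀ {M} → ¬ (k * k ≤ 10 * length (alice M)) → length (alice M) ≤ c
  fits {M} ¬long = begin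
    len               ≡⟨ m*n/n≡m len 10 ⟨
    len * 10 / 10     ≤⟨ /-monoˡ-≤ 10 (ℕP.≤-trans (ℕP.≤-reflexive (ℕP.*-comm len 10)) (ℕP.≰⇒≥ ¬long)) ⟩
    k * k / 10        ∎
    where
    open ℕP.≤-Reasoning
    len = length (alice M)
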